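{- Let $k$ be a non-negative integer and let $G\in\Delta_k$. Then $G$ has linear rank-width larger than $k$. Moreover, every vertex-minor $H$ of $G$ with $|V(H)|=|V(G)|-1$ has linear rank-width at most $k$.
   Context: All graphs are finite and simple. For $X\subseteq V(G)$, $\mathrm{cutrk}_G(X)$ is the rank over the binary field of the submatrix of the adjacency matrix of $G$ with rows $X$ and columns $V(G)\setminus X$. A linear layout of $G$ is an ordering $(v_1,\dots,v_n)$ of $V(G)$. Its width is $\max_i \mathrm{cutrk}_G(\{v_1,\dots,v_i\})$, or $0$ if $n\le1$. The linear rank-width of $G$ is the minimum width of a linear layout. $G*v$ denotes local complementation at $v$: the induced subgraph on the neighborhood of $v$ is replaced by its complement. A vertex-minor of $G$ is any graph obtainable from $G$ by a sequence of vertex deletions and local complementations. A delta composition of graphs $G_1,G_2,G_3$ is obtained from their disjoint union by choosing $v_i\in V(G_i)$ for $i=1,2,3$ and adding the triangle $v_1v_2v_3$, called the main triangle. $\Delta_0=\{K_2\}$. For $i\ge1$, $\Delta_i$ is the set of all delta compositions of three (not necessarily distinct) graphs in $\Delta_{i-1}$. Membership in $\Delta_i$ is understood up to isomorphism. -}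

module Defs where

open import Data.Nat using (ℕ; zero; suc; _+_; _≤_)
open import Data.Fin using (Fin; zero; suc; toℕ; punchIn; splitAt; _≟_)
open import Data.Bool using (Bool; true; false; _∧_; _xor_; if_then_else_; not)
open import Data.Sum using (_⊎_; inj₁; inj₂)
open import Data.Product using (Σ; ∃; _×_; _,_)
open import Relation.Nullary using (¬_; does)
open import Relation.Binary.PropositionalEquality using (_≡_)
open import Function.Definitions using (Injective)

-- Graphs on vertex set Fin n, given by a Bool adjacency function.
-- (Simplicity -- symmetry and irreflexivity -- is not stored in the
-- record; every graph occurring in the theorem is isomorphic to one
-- built from K₂ by delta compositions, hence simple, and vertex
-- deletion / local complementation preserve simplicity.)

record Graph : Set where
  constructor mkGraph
  field
    n   : ℕ
    adj : Fin n → Fin n → Bool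
open Graph public

record Iso (H G : Graph) : Set where
  field
    to      : Fin (n H) → Fin (n G)
    from    : Fin (n G) → Fin (n H)
    to-from : ∀ y → to (from y) ≡ y
    from-to : ∀ x → from (to x) ≡ x
    pres    : ∀ x y → adj H x y ≡ adj G (to x) (to y)

parity : ∀ {t} → (Fin t → Bool) → Bool
parity {zero}  f = false
parity {suc t} f = f zero xor parity (λ i → f (suc i))

-- CutRankGE G X t : the matrix A_G[X, V(G) ∖ X] (over GF(2)) has t
-- linearly independent rows, i.e. rank ≥ t.  The rows are given by
-- f : Fin t → V(G) (all in X); independence means every nonempty
-- subset S of these rows has nonzero GF(2)-sum, i.e. some column
-- y ∉ X has an odd number of ones among the selected rows.
-- Thus cutrk_G(X) ≥ t ⇔ CutRankGE G X t, and cutrk_G(X) ≤ k ⇔ ¬ CutRankGE G X (suc k).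
CutRankGE : (G : Graph) → (Fin (n G) → Set) → ℕ → Set
CutRankGE G X t =
  Σ (Fin t → Fin (n G)) λ f →
    (∀ i → X (f i)) ×
    (∀ (S : Fin t → Bool) → (∃ λ i → S i ≡ true) →
       ∃ λ y → ¬ X y × (parity (λ i → S i ∧ adj G (f i) y) ≡ true))

-- A linear layout: an ordering (v₁,…,vₙ), given as an injective map
-- position ↦ vertex on Fin n (hence a bijection).
record Layout (G : Graph) : Set where
  field
    ord : Fin (n G) → Fin (n G)
    inj : Injective _≡_ _≡_ ord
open Layout public

-- the prefix {v₁, …, v_{i+1}} for i : Fin n (so i+1 ranges over 1..n)
prefix : (G : Graph) → Layout G → Fin (n G) → Fin (n G) → Set
prefix G L i v = ∃ λ j → (toℕ j ≤ toℕ i) × (ord L j ≡ v)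

-- width of L is at most k (max over prefixes of cutrk; vacuous, i.e. 0, if n = 0)
WidthLE : (G : Graph) → Layout G → ℕ → Set
WidthLE G L k = ∀ (i : Fin (n G)) → ¬ CutRankGE G (prefix G L i) (suc k)

LRWLE : Graph → ℕ → Set
LRWLE G k = Σ (Layout G) λ L → WidthLE G L k

_*_ : (G : Graph) → Fin (n G) → Graph
G * v = mkGraph (n G) (λ x y →
  adj G x y xor (not (does (x ≟ y)) ∧ adj G x v ∧ adj G y v))

_─_ : (G : Graph) → Fin (n G) → Graph
mkGraph zero a    ─ ()
mkGraph (suc m) a ─ v = mkGraph m (λ x y → a (punchIn v x) (punchIn v y))

data VertexMinor (H : Graph) : Graph → Set where
  vm-iso : ∀ {G} → Iso H G → VertexMinor H G
  vm-lc  : ∀ {G} (v : Fin (n G)) → VertexMinor H (G * v) → VertexMinor H G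
  vm-del : ∀ {G} (v : Fin (n G)) → VertexMinor H (G ─ v) → VertexMinor H G

K₂ : Graph
K₂ = mkGraph 2 (λ x y → not (does (x ≟ y)))

part : ∀ {a b c} → Fin (a + (b + c)) → Fin a ⊎ (Fin b ⊎ Fin c)
part {a} {b} {c} x with splitAt a x
... | inj₁ p = inj₁ p
... | inj₂ q with splitAt b q
...   | inj₁ r = inj₂ (inj₁ r)
...   | inj₂ s = inj₂ (inj₂ s)

deltaComp : (G₁ G₂ G₃ : Graph) → Fin (n G₁) → Fin (n G₂) → Fin (n G₃) → Graph
deltaComp G₁ G₂ G₃ v₁ v₂ v₃ =
  mkGraph (n G₁ + (n G₂ + n G₃)) (λ x y → edge (part x) (part y))
  where
  main : Fin (n G₁) ⊎ (Fin (n G₂) ⊎ Fin (n G₃)) → Bool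
  main (inj₁ a)        = does (a ≟ v₁)
  main (inj₂ (inj₁ b)) = does (b ≟ v₂)
  main (inj₂ (inj₂ c)) = does (c ≟ v₃)
  edge : Fin (n G₁) ⊎ (Fin (n G₂) ⊎ Fin (n G₃)) →
         Fin (n G₁) ⊎ (Fin (n G₂) ⊎ Fin (n G₃)) → Bool
  edge (inj₁ a)        (inj₁ a')        = adj G₁ a a'
  edge (inj₂ (inj₁ b)) (inj₂ (inj₁ b')) = adj G₂ b b'
  edge (inj₂ (inj₂ c)) (inj₂ (inj₂ c')) = adj G₃ c c'
  edge p q = main p ∧ main q

data InDelta : ℕ → Graph → Set where
  Δ-base : ∀ {G} → Iso G K₂ → InDelta 0 G
  Δ-comp : ∀ {i G G₁ G₂ G₃} →
           InDelta i G₁ → InDelta i G₂ → InDelta i G₃ →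
           (v₁ : Fin (n G₁)) (v₂ : Fin (n G₂)) (v₃ : Fin (n G₃)) →
           Iso G (deltaComp G₁ G₂ G₃ v₁ v₂ v₃) → InDelta (suc i) G

{-# OPTIONS --safe #-}

-- Lower bound. Let G be composed of A, B, C, and fix a layout of G. Each part has a
-- prefix of cut-rank at least k; take the middle one of the three, say for B. At that
-- prefix the union of A and C, which is connected, is cut as well, and this adds 1 to
-- the cut-rank because only one vertex of B has neighbours outside B.
--
-- Upper bound. For v in A, order the vertices as B, then A without v, then C. While A
-- is being cut, pivoting on the edge between B and C costs rank 1 and leaves the cut
-- of a vertex-minor of A with v removed, so that induction applies. While B (or C) is
-- being cut, all of the outside looks like one pendant vertex of B, so one needs
-- layouts of width k + 1 for G with a pendant vertex attached, placed at one end.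
-- Every graph locally equivalent to G, with v deleted, is reached from three cut
-- matrices attached to (G , v); these are permuted by local complementation.

module Submission where

open import Defs
open import Data.Bool using (Bool; true; false; _∧_; _xor_; not; _∨_) renaming (_≟_ to _≟ᵇ_)
open import Data.Bool.Properties using (xor-identityʳ; xor-same; ∧-comm; ∧-assoc; ∧-idem; ∧-zeroʳ; ∧-identityʳ; ∧-distribˡ-xor; ¬-not)
open import Data.Bool.Solver using (module xor-∧-Solver)
open import Data.Empty using (⊥)
open import Data.Fin using (Fin; zero; suc; toℕ; fromℕ<; punchIn; punchOut; splitAt; _↑ˡ_; _↑ʳ_; _≟_)
open import Data.Fin.Properties using (any?; toℕ<n; toℕ-fromℕ<; toℕ-injective; punchOut-injective; injective⇒≤; splitAt-↑ˡ; splitAt-↑ʳ; splitAt⁻¹-↑ˡ; splitAt⁻¹-↑ʳ; punchIn-injective; punchInᵢ≢i)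
open import Data.Fin.Subset using (Subset; _∈_; ∣_∣)
open import Data.Fin.Subset.Properties using (p⊂q⇒∣p∣<∣q∣; ∣⊤∣≡n; ∈⊤)
open import Data.Nat using (ℕ; zero; suc; _+_; _∸_; _≤_; _<_; _<?_; _≤?_; z≤n; s≤s)
open import Data.Nat.Properties hiding (_≟_)
open import Data.Product using (Σ; ∃; _×_; _,_; proj₁; proj₂)
open import Data.Sum using (_⊎_; inj₁; inj₂; [_,_]′)
open import Data.Sum.Properties using (inj₁-injective; inj₂-injective)
open import Data.Unit using (⊤; tt)
open import Data.Vec using (Vec; []; _∷_; zipWith; map; replicate; head; tail; tabulate)
open import Data.Vec.Functional using (insertAt)
open import Data.Vec.Functional.Properties using (insertAt-lookup; insertAt-punchIn)
open import Data.Vec.Properties using (lookup⇒[]=; []=⇒lookup; lookup∘tabulate)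
open import Function using (_∘_; id; const)
open import Function.Definitions using (Injective)
open import Relation.Binary.Definitions using (tri<; tri≈; tri>)
open import Relation.Binary.PropositionalEquality using (_≡_; _≢_; refl; sym; trans; cong; cong₂; subst; subst₂; module ≡-Reasoning)
open import Relation.Nullary using (¬_; Dec; yes; no; does; contradiction)
open import Relation.Nullary.Decidable using (dec-true; dec-false)

open xor-∧-Solver using (solve; _:=_; _:+_; _:*_)

private
  variable
    k m r t : ℕ
    V W : Set

does-true : ∀ {P : Set} (P? : Dec P) → does P? ≡ true → P
does-true (yes p) _ = p

-- Linear algebra over the binary field

infix 7 _·_
_·_ : Vec Bool r → Vec Bool r → Bool
[]      · []      = false
(a ∷ u) · (b ∷ w) = (a ∧ b) xor (u · w)

infixl 6 _+[_]_
_+[_]_ : Vec Bool r → Bool → Vec Bool r → Vec Bool r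
u +[ b ] w = zipWith (λ s t → s xor (b ∧ t)) u w

_∙_ : Bool → Vec Bool r → Vec Bool r
b ∙ w = map (b ∧_) w

𝟎 : Vec Bool r
𝟎 = replicate _ false

·-comm : (u w : Vec Bool r) → u · w ≡ w · u
·-comm []      []      = refl
·-comm (a ∷ u) (b ∷ w) = cong₂ _xor_ (∧-comm a b) (·-comm u w)

+[]-·ˡ : ∀ (u : Vec Bool r) b w z → (u +[ b ] w) · z ≡ u · z xor (b ∧ (w · z))
+[]-·ˡ []      b []      []      = sym (∧-zeroʳ b)
+[]-·ˡ (s ∷ u) b (t ∷ w) (a ∷ z) = trans (cong (((s xor (b ∧ t)) ∧ a) xor_) (+[]-·ˡ u b w z))
  (solve 6 (λ s b t a p q → (s :+ b :* t) :* a :+ (p :+ b :* q) := (s :* a :+ p) :+ b :* (t :* a :+ q))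
    refl s b t a (u · z) (w · z))

+[]-·ʳ : ∀ (z u : Vec Bool r) b w → z · (u +[ b ] w) ≡ z · u xor (b ∧ (z · w))
+[]-·ʳ z u b w = trans (·-comm z _) (trans (+[]-·ˡ u b w z)
  (cong₂ _xor_ (·-comm u z) (cong (b ∧_) (·-comm w z))))

∙-·ˡ : ∀ b (w z : Vec Bool r) → (b ∙ w) · z ≡ b ∧ (w · z)
∙-·ˡ b []      []      = sym (∧-zeroʳ b)
∙-·ˡ b (t ∷ w) (a ∷ z) = trans (cong₂ _xor_ (∧-assoc b t a) (∙-·ˡ b w z))
  (sym (∧-distribˡ-xor b (t ∧ a) (w · z)))

∙-·ʳ : ∀ b (z w : Vec Bool r) → z · (b ∙ w) ≡ b ∧ (z · w)
∙-·ʳ b z w = trans (·-comm z _) (trans (∙-·ˡ b w z) (cong (b ∧_) (·-comm w z)))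

𝟎-·ˡ : (z : Vec Bool r) → 𝟎 · z ≡ false
𝟎-·ˡ []      = refl
𝟎-·ˡ (a ∷ z) = 𝟎-·ˡ z

𝟎-·ʳ : (z : Vec Bool r) → z · 𝟎 ≡ false
𝟎-·ʳ z = trans (·-comm z 𝟎) (𝟎-·ˡ z)

xor-𝟎-·ˡ : ∀ b (z : Vec Bool r) → b xor (𝟎 · z) ≡ b
xor-𝟎-·ˡ b z = trans (cong (b xor_) (𝟎-·ˡ z)) (xor-identityʳ b)

xor-𝟎-·ʳ : ∀ b (z : Vec Bool r) → b xor (z · 𝟎) ≡ b
xor-𝟎-·ʳ b z = trans (cong (b xor_) (𝟎-·ʳ z)) (xor-identityʳ b)

parity-cong : {f g : Fin t → Bool} → (∀ i → f i ≡ g i) → parity f ≡ parity g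
parity-cong {zero}  eq = refl
parity-cong {suc t} eq = cong₂ _xor_ (eq zero) (parity-cong (λ i → eq (suc i)))

parity-false : {f : Fin t → Bool} → (∀ i → f i ≡ false) → parity f ≡ false
parity-false {zero}  eq = refl
parity-false {suc t} eq = cong₂ _xor_ (eq zero) (parity-false (λ i → eq (suc i)))

parity-xor-∧ : (f g : Fin t → Bool) (b : Bool) →
  parity (λ i → f i xor (g i ∧ b)) ≡ parity f xor (parity g ∧ b)
parity-xor-∧ {zero}  f g b = refl
parity-xor-∧ {suc t} f g b = trans
  (cong ((f zero xor (g zero ∧ b)) xor_) (parity-xor-∧ (f ∘ suc) (g ∘ suc) b))
  (solve 5 (λ s u b p q → (s :+ u :* b) :+ (p :+ q :* b) := (s :+ p) :+ (u :+ q) :* b)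
    refl (f zero) (g zero) b (parity (f ∘ suc)) (parity (g ∘ suc)))

parity-punchIn : (j : Fin (suc t)) (f : Fin (suc t) → Bool) →
  parity f ≡ f j xor parity (f ∘ punchIn j)
parity-punchIn             zero    f = refl
parity-punchIn {t = suc t} (suc j) f = trans (cong (f zero xor_) (parity-punchIn j (f ∘ suc)))
  (solve 3 (λ a b c → a :+ (b :+ c) := b :+ (a :+ c)) refl (f zero) (f (suc j)) _)

-- Gaussian elimination on the first coordinate. The selected sum is tested against every `u`,
-- because the entries of a factorised matrix are such products.
dependent : (vs : Fin (suc t) → Vec Bool t) →
  ∃ λ (S : Fin (suc t) → Bool) → (∃ λ i → S i ≡ true) × (∀ u → parity (λ i → S i ∧ (vs i · u)) ≡ false)
dependent {zero} vs = (λ _ → true) , (zero , refl) , λ { [] → parity-false (λ i → nil (vs i)) }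
  where
  nil : (w : Vec Bool 0) → w · [] ≡ false
  nil [] = refl
dependent {suc t} vs with any? (λ i → head (vs i) ≟ᵇ true)
... | no heads = S , (suc (proj₁ ne) , proj₂ ne) , dep
  where
  ih = dependent (λ i → tail (vs (suc i)))
  S : Fin (suc (suc t)) → Bool
  -- Without a pivot the first coordinate is zero throughout, so dropping it together with one
  -- vector keeps a surplus of exactly one vector.
  S zero    = false
  S (suc i) = proj₁ ih i
  ne = proj₁ (proj₂ ih)
  dot-tail : (w : Vec Bool (suc t)) → head w ≢ true → ∀ c u → w · (c ∷ u) ≡ tail w · u
  dot-tail (true  ∷ w) h c u = contradiction refl h
  dot-tail (false ∷ w) h c u = refl
  dep : ∀ u → parity (λ i → S i ∧ (vs i · u)) ≡ false
  dep (c ∷ u) = trans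
    (parity-cong λ i → cong (proj₁ ih i ∧_) (dot-tail (vs (suc i)) (λ h → heads (suc i , h)) c u))
    (proj₂ (proj₂ ih) u)
... | yes (j , pivot) = S , (punchIn j (proj₁ ne) , trans (insertAt-punchIn S′ j s (proj₁ ne)) (proj₂ ne)) , dep
  where
  ih = dependent (λ i → tail (vs (punchIn j i)) +[ head (vs (punchIn j i)) ] tail (vs j))
  S′ = proj₁ ih
  ne = proj₁ (proj₂ ih)
  -- The pivot was added to each selected vector with leading 1, so its own coefficient is the
  -- parity of their number.
  s  = parity (λ i → S′ i ∧ head (vs (punchIn j i)))
  S  = insertAt S′ j s
  reduce : (w z : Vec Bool (suc t)) → head z ≡ true → ∀ c u →
    w · (c ∷ u) ≡ ((tail w +[ head w ] tail z) · u) xor (head w ∧ (z · (c ∷ u)))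
  reduce (a ∷ w) (true ∷ z) refl c u rewrite +[]-·ˡ w a z u =
    solve 4 (λ a c p q → a :* c :+ p := (p :+ a :* q) :+ a :* (c :+ q)) refl a c (w · u) (z · u)
  dep : ∀ u → parity (λ i → S i ∧ (vs i · u)) ≡ false
  dep (c ∷ u) = begin
    parity (λ i → S i ∧ (vs i · (c ∷ u)))
      ≡⟨ parity-punchIn j (λ i → S i ∧ (vs i · (c ∷ u))) ⟩
    (S j ∧ d) xor parity (λ i → S (punchIn j i) ∧ (vs (punchIn j i) · (c ∷ u)))
      ≡⟨ cong₂ _xor_ (cong (_∧ d) (insertAt-lookup S′ j s)) (parity-cong summand) ⟩
    (s ∧ d) xor parity (λ i → (S′ i ∧ (w i · u)) xor ((S′ i ∧ head (vs (punchIn j i))) ∧ d))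
      ≡⟨ cong ((s ∧ d) xor_) (parity-xor-∧ (λ i → S′ i ∧ (w i · u)) (λ i → S′ i ∧ head (vs (punchIn j i))) d) ⟩
    (s ∧ d) xor (parity (λ i → S′ i ∧ (w i · u)) xor (s ∧ d))
      ≡⟨ cong (λ b → (s ∧ d) xor (b xor (s ∧ d))) (proj₂ (proj₂ ih) u) ⟩
    (s ∧ d) xor (s ∧ d)
      ≡⟨ xor-same (s ∧ d) ⟩
    false ∎
    where
    open ≡-Reasoning
    d = vs j · (c ∷ u)
    w : Fin (suc t) → Vec Bool t
    w i = tail (vs (punchIn j i)) +[ head (vs (punchIn j i)) ] tail (vs j)
    summand : ∀ i → S (punchIn j i) ∧ (vs (punchIn j i) · (c ∷ u)) ≡
      (S′ i ∧ (w i · u)) xor ((S′ i ∧ head (vs (punchIn j i))) ∧ d)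
    summand i rewrite insertAt-punchIn S′ j s i | reduce (vs (punchIn j i)) (vs j) pivot c u =
      trans (∧-distribˡ-xor (S′ i) _ _) (cong ((S′ i ∧ (w i · u)) xor_) (sym (∧-assoc (S′ i) _ d)))

-- Linear layouts and injective keys

injective⇒surjective : {f : Fin m → Fin m} → Injective _≡_ _≡_ f → ∀ y → ∃ λ x → f x ≡ y
injective⇒surjective {suc m} {f} f-inj y with any? (λ x → f x ≟ y)
... | yes p = p
... | no ¬p = contradiction
  (injective⇒≤ {f = λ x → punchOut (λ eq → ¬p (x , sym eq))}
    (λ eq → f-inj (punchOut-injective (λ e → ¬p (_ , sym e)) (λ e → ¬p (_ , sym e)) eq)))
  1+n≰n

-- A layout is encoded by an injective key; its cuts are the sets {x | key x < c}.
KeyLRWLE : Graph → ℕ → Set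
KeyLRWLE G k = Σ (Fin (n G) → ℕ) λ key → Injective _≡_ _≡_ key ×
  (∀ c → ¬ CutRankGE G (λ x → key x < c) (suc k))

CutRankGE-resp : ∀ G {X Y : Fin (n G) → Set} → (∀ {x} → X x → Y x) → (∀ {x} → Y x → X x) →
  CutRankGE G X t → CutRankGE G Y t
CutRankGE-resp G X⊆Y Y⊆X (f , f∈X , ind) = f , (λ i → X⊆Y (f∈X i)) ,
  λ S ne → let y , y∉X , odd = ind S ne in y , (λ y∈Y → y∉X (Y⊆X y∈Y)) , odd

LRWLE⇒Key : ∀ {G k} → LRWLE G k → KeyLRWLE G k
LRWLE⇒Key {G} {k} (L , width) = key , key-inj , thin
  where
  pos : Fin (n G) → Fin (n G)
  pos v = proj₁ (injective⇒surjective (inj L) v)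
  ord-pos : ∀ v → ord L (pos v) ≡ v
  ord-pos v = proj₂ (injective⇒surjective (inj L) v)
  key : Fin (n G) → ℕ
  key = toℕ ∘ pos
  key-inj : Injective _≡_ _≡_ key
  key-inj {x} {y} eq = trans (sym (ord-pos x)) (trans (cong (ord L) (toℕ-injective eq)) (ord-pos y))
  thin : ∀ c → ¬ CutRankGE G (λ x → key x < c) (suc k)
  thin zero (f , f∈X , _) = n≮0 (f∈X zero)
  thin (suc c) rk with c <? n G
  ... | yes c<n = width (fromℕ< c<n) (CutRankGE-resp G to′ from′ rk)
    where
    to′ : ∀ {x} → key x < suc c → prefix G L (fromℕ< c<n) x
    to′ {x} lt = pos x , subst (key x ≤_) (sym (toℕ-fromℕ< c<n)) (≤-pred lt) , ord-pos x
    from′ : ∀ {x} → prefix G L (fromℕ< c<n) x → key x < suc c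
    from′ {x} (j , j≤i , eq) = s≤s (subst₂ _≤_
      (cong toℕ (inj L (trans eq (sym (ord-pos x))))) (toℕ-fromℕ< c<n) j≤i)
  -- Past the last position every vertex lies in the cut, and no column is left to witness
  -- independence.
  ... | no c≮n = let y , y∉X , _ = proj₂ (proj₂ rk) (λ _ → true) (zero , refl)
                 in y∉X (m≤n⇒m≤1+n (<-≤-trans (toℕ<n (pos y)) (≮⇒≥ c≮n)))

module Sorting (key : Fin m → ℕ) (key-inj : Injective _≡_ _≡_ key) where

  below : ℕ → Subset m
  below c = tabulate (λ w → does (key w <? c))

  below⁺ : ∀ {c w} → key w < c → w ∈ below c
  below⁺ {c} {w} lt = lookup⇒[]= w _ (trans (lookup∘tabulate _ w) (dec-true (key w <? c) lt))

  below⁻ : ∀ {c w} → w ∈ below c → key w < c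
  below⁻ {c} {w} w∈ = does-true (key w <? c) (trans (sym (lookup∘tabulate _ w)) ([]=⇒lookup w∈))

  -- Keys are compressed to positions by counting the smaller ones; `v` does not count itself, which
  -- keeps its position below `m`.
  place : Fin m → Fin m
  place v = fromℕ< {∣ below (key v) ∣} (subst (∣ below (key v) ∣ <_) (∣⊤∣≡n m)
    (p⊂q⇒∣p∣<∣q∣ ((λ _ → ∈⊤) , v , ∈⊤ , λ v∈ → <-irrefl refl (below⁻ v∈))))

  place-mono : ∀ {u v} → key u < key v → toℕ (place u) < toℕ (place v)
  place-mono {u} {v} lt = subst₂ _<_ (sym (toℕ-fromℕ< _)) (sym (toℕ-fromℕ< _))
    (p⊂q⇒∣p∣<∣q∣ ((λ w∈ → below⁺ (<-trans (below⁻ w∈) lt)) , u , below⁺ lt , λ u∈ → <-irrefl refl (below⁻ u∈)))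

  place-mono-≤ : ∀ {u v} → key u ≤ key v → toℕ (place u) ≤ toℕ (place v)
  place-mono-≤ le with m≤n⇒m<n∨m≡n le
  ... | inj₁ lt = <⇒≤ (place-mono lt)
  ... | inj₂ eq = ≤-reflexive (cong (toℕ ∘ place) (key-inj eq))

  place-reflects : ∀ {u v} → toℕ (place u) ≤ toℕ (place v) → key u ≤ key v
  place-reflects le = ≮⇒≥ λ lt → <⇒≱ (place-mono lt) le

  place-injective : Injective _≡_ _≡_ place
  place-injective eq = key-inj (≤-antisym
    (place-reflects (≤-reflexive (cong toℕ eq))) (place-reflects (≤-reflexive (cong toℕ (sym eq)))))

Key⇒LRWLE : ∀ {G k} → KeyLRWLE G k → LRWLE G k
Key⇒LRWLE {G} {k} (key , key-inj , thin) = L , λ i rk →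
  thin (suc (key (vertex i))) (CutRankGE-resp G (to′ i) (from′ i) rk)
  where
  open Sorting key key-inj
  vertex : Fin (n G) → Fin (n G)
  vertex i = proj₁ (injective⇒surjective place-injective i)
  place-vertex : ∀ i → place (vertex i) ≡ i
  place-vertex i = proj₂ (injective⇒surjective place-injective i)
  L : Layout G
  L = record { ord = vertex ; inj = λ {i} {j} eq →
    trans (sym (place-vertex i)) (trans (cong place eq) (place-vertex j)) }
  to′ : ∀ i {x} → prefix G L i x → key x < suc (key (vertex i))
  to′ i (j , j≤i , refl) = s≤s (place-reflects
    (subst₂ _≤_ (cong toℕ (sym (place-vertex j))) (cong toℕ (sym (place-vertex i))) j≤i))
  from′ : ∀ i {x} → key x < suc (key (vertex i)) → prefix G L i x
  from′ i {x} (s≤s le) = place x ,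
    subst (toℕ (place x) ≤_) (cong toℕ (place-vertex i)) (place-mono-≤ le) ,
    place-injective (place-vertex (place x))

-- Arrangements and factorised cut matrices

record Simple (G : Graph) : Set where
  field
    symm : ∀ x y → adj G x y ≡ adj G y x
    irr  : ∀ x → adj G x x ≡ false

-- Keys may skip values, so restriction to a part is mere composition; `bound` supplies the shift
-- for concatenation and the reflection point for reversal.
record Arrangement (V : Set) : Set where
  field
    key       : V → ℕ
    bound     : ℕ
    key<bound : ∀ x → key x < bound
    key-inj   : Injective _≡_ _≡_ key

  Low High : ℕ → V → Set
  Low  c x = key x < c
  High c x = c ≤ key x
open Arrangement

pullArr : {φ : W → V} → Injective _≡_ _≡_ φ → Arrangement V → Arrangement W
pullArr {φ = φ} φ-inj l = record
  { key = key l ∘ φ ; bound = bound l ; key<bound = λ x → key<bound l (φ x)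
  ; key-inj = λ eq → φ-inj (key-inj l eq) }

reverse : Arrangement V → Arrangement V
reverse l = record
  { key       = λ x → bound l ∸ suc (key l x)
  ; bound     = suc (bound l)
  ; key<bound = λ x → s≤s (m∸n≤m (bound l) (suc (key l x)))
  ; key-inj   = λ eq → key-inj l (suc-injective (∸-cancelˡ-≡ (key<bound l _) (key<bound l _) eq)) }

reverse-High : (l : Arrangement V) → ∀ c {x} → High (reverse l) c x → Low l (bound l ∸ c) x
reverse-High l c {x} le = m+n≤o⇒m≤o∸n (suc (key l x))
  (subst (_≤ bound l) (+-comm c (suc (key l x))) (m≤o∸n⇒m+n≤o c (key<bound l x) le))

reverse-Low : (l : Arrangement V) → ∀ c {x} → Low (reverse l) c x → High l (bound l ∸ c) x
reverse-Low l c {x} lt = m≤n+o⇒m∸n≤o (bound l) c (begin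
  bound l                                             ≤⟨ m≤n+m∸n (bound l) (suc (key l x)) ⟩
  suc (key l x + (bound l ∸ suc (key l x)))           ≡⟨ +-suc (key l x) _ ⟨
  key l x + suc (bound l ∸ suc (key l x))             ≤⟨ +-monoʳ-≤ (key l x) lt ⟩
  key l x + c                                         ≡⟨ +-comm (key l x) c ⟩
  c + key l x                                         ∎)
  where open ≤-Reasoning

-- Rank at most r is expressed by a factorisation through vectors of length r.
-- Here the matrix is the L × R part of E, extended by the column m.
record Marked (E : V → V → Bool) (m : V → Bool) (L R : V → Set) (r : ℕ) : Set where
  field
    row col : V → Vec Bool r
    ext     : Vec Bool r
    cut     : ∀ {x y} → L x → R y → E x y ≡ row x · col y
    cut-ext : ∀ {x} → L x → m x ≡ row x · ext

  cut-ext-∙ : ∀ β {x} → L x → m x ∧ β ≡ row x · (β ∙ ext)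
  cut-ext-∙ β {x} lx = trans (∧-comm (m x) β)
    (trans (cong (β ∧_) (cut-ext lx)) (sym (∙-·ʳ β (row x) ext)))

  ∙-cut-ext : ∀ β {x} → L x → β ∧ m x ≡ (β ∙ ext) · row x
  ∙-cut-ext β {x} lx = trans (∧-comm β (m x)) (trans (cut-ext-∙ β lx) (·-comm (row x) _))

-- The cut matrix of E with v replaced by two copies, one on either side of the cut:
-- both copies keep the neighbours of v if p holds and none otherwise, and e says
-- whether they are adjacent to each other. Up to the dimension spent on the copies,
-- (p , e) = (false , true), (true , true), (true , false) are the cut matrices of
-- G ─ v, (G * v) ─ v and (G ∧ vw) ─ v, for w a neighbour of v.
record Split (E : V → V → Bool) (v : V) (p e : Bool) (L R : V → Set) (r : ℕ) : Set where
  field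
    row col : V → Vec Bool r
    row′ col′ : Vec Bool r
    cut     : ∀ {x y} → x ≢ v → y ≢ v → L x → R y → E x y ≡ row x · col y
    cut-col : ∀ {x} → x ≢ v → L x → p ∧ E x v ≡ row x · col′
    cut-row : ∀ {y} → y ≢ v → R y → p ∧ E v y ≡ row′ · col y
    corner  : e ≡ row′ · col′

module _ {E : V → V → Bool} {F : W → W → Bool} {φ : W → V}
         (pres : ∀ x y → F x y ≡ E (φ x) (φ y)) where

  -- A submatrix inherits the factorisation. This serves both transport along embeddings and
  -- shrinking the two sides of a cut.
  pullMarked : ∀ {m : V → Bool} {m′ : W → Bool} {L R L′ R′} → (∀ x → m′ x ≡ m (φ x)) →
    (∀ x → L′ x → L (φ x)) → (∀ x → R′ x → R (φ x)) →
    Marked E m L R r → Marked F m′ L′ R′ r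
  pullMarked m≡ L⊆ R⊆ M = record
    { row = M.row ∘ φ ; col = M.col ∘ φ ; ext = M.ext
    ; cut = λ lx ry → trans (pres _ _) (M.cut (L⊆ _ lx) (R⊆ _ ry))
    ; cut-ext = λ lx → trans (m≡ _) (M.cut-ext (L⊆ _ lx)) }
    where module M = Marked M

  pullSplit : Injective _≡_ _≡_ φ → ∀ {v p e L R L′ R′} →
    (∀ x → L′ x → L (φ x)) → (∀ x → R′ x → R (φ x)) →
    Split E (φ v) p e L R r → Split F v p e L′ R′ r
  pullSplit φ-inj {p = p} L⊆ R⊆ M = record
    { row = M.row ∘ φ ; col = M.col ∘ φ ; row′ = M.row′ ; col′ = M.col′
    ; cut = λ x≢ y≢ lx ry → trans (pres _ _) (M.cut (x≢ ∘ φ-inj) (y≢ ∘ φ-inj) (L⊆ _ lx) (R⊆ _ ry))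
    ; cut-col = λ x≢ lx → trans (cong (p ∧_) (pres _ _)) (M.cut-col (x≢ ∘ φ-inj) (L⊆ _ lx))
    ; cut-row = λ y≢ ry → trans (cong (p ∧_) (pres _ _)) (M.cut-row (y≢ ∘ φ-inj) (R⊆ _ ry))
    ; corner = M.corner }
    where module M = Split M

-- Cuts of a delta composition

pattern in₁ x = inj₁ x
pattern in₂ x = inj₂ (inj₁ x)
pattern in₃ x = inj₂ (inj₂ x)

at : ∀ {m} → Fin m → Fin m → Bool
at v x = does (x ≟ v)

at-refl : ∀ {m} (v : Fin m) → at v v ≡ true
at-refl v = dec-true (v ≟ v) refl

-- The rank-one matrix of a single-vertex indicator is zero off the diagonal, so adding it changes
-- no entry across a cut.
at-disjoint : ∀ {m} {v x y : Fin m} → x ≢ y → at v x ∧ at v y ≡ false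
at-disjoint {v = v} {x} {y} x≢y with x ≟ v
... | yes refl = dec-false (y ≟ v) (x≢y ∘ sym)
... | no _ = refl

Parts : (A B C : Graph) → Set
Parts A B C = Fin (n A) ⊎ (Fin (n B) ⊎ Fin (n C))

on : {X Y Z : Set} → (X → Set) → (Y → Set) → (Z → Set) → X ⊎ (Y ⊎ Z) → Set
on P Q S = [ P , [ Q , S ]′ ]′

module Edge (A B C : Graph) (a : Fin (n A)) (b : Fin (n B)) (c : Fin (n C)) where

  edge : Parts A B C → Parts A B C → Bool
  edge (in₁ x) (in₁ y) = adj A x y
  edge (in₁ x) (in₂ y) = at a x ∧ at b y
  edge (in₁ x) (in₃ y) = at a x ∧ at c y
  edge (in₂ x) (in₁ y) = at b x ∧ at a y
  edge (in₂ x) (in₂ y) = adj B x y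
  edge (in₂ x) (in₃ y) = at b x ∧ at c y
  edge (in₃ x) (in₁ y) = at c x ∧ at a y
  edge (in₃ x) (in₂ y) = at c x ∧ at b y
  edge (in₃ x) (in₃ y) = adj C x y

  concatenate : Arrangement (Fin (n B)) → Arrangement (Fin (n A)) → Arrangement (Fin (n C)) →
    Arrangement (Parts A B C)
  concatenate lb la lc = record { key = K ; bound = nb + (na + bound lc) ; key<bound = K< ; key-inj = K-inj _ _ }
    where
    nb = bound lb
    na = bound la
    K : Parts A B C → ℕ
    K (in₁ x) = nb + key la x
    K (in₂ x) = key lb x
    K (in₃ x) = nb + (na + key lc x)
    K< : ∀ x → K x < nb + (na + bound lc)
    K< (in₁ x) = +-monoʳ-< nb (<-≤-trans (key<bound la x) (m≤m+n na _))
    K< (in₂ x) = <-≤-trans (key<bound lb x) (m≤m+n nb _)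
    K< (in₃ x) = +-monoʳ-< nb (+-monoʳ-< na (key<bound lc x))
    b≢ : ∀ {x m} → key lb x ≢ nb + m
    b≢ {x} {m} eq = m+n≮m nb m (subst (_< nb) eq (key<bound lb x))
    a≢ : ∀ {x m} → nb + key la x ≢ nb + (na + m)
    a≢ {x} {m} eq = m+n≮m na m (subst (_< na) (+-cancelˡ-≡ nb _ _ eq) (key<bound la x))
    K-inj : ∀ x y → K x ≡ K y → x ≡ y
    K-inj (in₁ x) (in₁ y) eq = cong in₁ (key-inj la (+-cancelˡ-≡ nb _ _ eq))
    K-inj (in₁ x) (in₂ y) eq = contradiction (sym eq) b≢
    K-inj (in₁ x) (in₃ y) eq = contradiction eq a≢
    K-inj (in₂ x) (in₁ y) eq = contradiction eq b≢
    K-inj (in₂ x) (in₂ y) eq = cong (λ z → in₂ z) (key-inj lb eq)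
    K-inj (in₂ x) (in₃ y) eq = contradiction eq b≢
    K-inj (in₃ x) (in₁ y) eq = contradiction (sym eq) a≢
    K-inj (in₃ x) (in₂ y) eq = contradiction (sym eq) b≢
    K-inj (in₃ x) (in₃ y) eq = cong (λ z → in₃ z) (key-inj lc (+-cancelˡ-≡ na _ _ (+-cancelˡ-≡ nb _ _ eq)))

  private
    ∅ : {X : Set} → X → Set
    ∅ _ = ⊥
    U : {X : Set} → X → Set
    U _ = ⊤

  -- A cut of the concatenation in the order `B`, `A`, `C` goes through one part only. Since `P`
  -- passes to smaller sides, the other two parts may be taken wholly on one side.
  cutCase : (P : (L R : Parts A B C → Set) → Set) →
    (∀ {L R L′ R′} → (∀ x → L′ x → L x) → (∀ x → R′ x → R x) → P L R → P L′ R′) →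
    (lb : Arrangement (Fin (n B))) (la : Arrangement (Fin (n A))) (lc : Arrangement (Fin (n C))) →
    (∀ d → P (on ∅ (Low lb d) ∅) (on U (High lb d) U)) →
    (∀ d → P (on (Low la d) U ∅) (on (High la d) ∅ U)) →
    (∀ d → P (on U U (Low lc d)) (on ∅ ∅ (High lc d))) →
    ∀ d → P (Low (concatenate lb la lc) d) (High (concatenate lb la lc) d)
  cutCase P mono lb la lc first middle last d with d ≤? bound lb
  ... | yes d≤ = mono L⊆ R⊆ (first d)
    where
    L⊆ : ∀ x → Low (concatenate lb la lc) d x → on ∅ (Low lb d) ∅ x
    L⊆ (in₁ x) lt = m+n≮m (bound lb) _ (<-≤-trans lt d≤)
    L⊆ (in₂ x) lt = lt
    L⊆ (in₃ x) lt = m+n≮m (bound lb) _ (<-≤-trans lt d≤)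
    R⊆ : ∀ x → High (concatenate lb la lc) d x → on U (High lb d) U x
    R⊆ (in₁ x) _ = tt
    R⊆ (in₂ x) le = le
    R⊆ (in₃ x) _ = tt
  ... | no d≰ with d ∸ bound lb ≤? bound la
  ...   | yes d≤ = mono L⊆ R⊆ (middle (d ∸ bound lb))
    where
    eq : bound lb + (d ∸ bound lb) ≡ d
    eq = m+[n∸m]≡n (<⇒≤ (≰⇒> d≰))
    L⊆ : ∀ x → Low (concatenate lb la lc) d x → on (Low la (d ∸ bound lb)) U ∅ x
    L⊆ (in₁ x) lt = +-cancelˡ-< (bound lb) _ _ (subst (_ <_) (sym eq) lt)
    L⊆ (in₂ x) _ = tt
    L⊆ (in₃ x) lt = m+n≮m (bound la) _ (<-≤-trans (+-cancelˡ-< (bound lb) _ _ (subst (_ <_) (sym eq) lt)) d≤)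
    R⊆ : ∀ x → High (concatenate lb la lc) d x → on (High la (d ∸ bound lb)) ∅ U x
    R⊆ (in₁ x) le = +-cancelˡ-≤ (bound lb) _ _ (subst (_≤ _) (sym eq) le)
    R⊆ (in₂ x) le = d≰ (≤-trans le (<⇒≤ (key<bound lb x)))
    R⊆ (in₃ x) _ = tt
  ...   | no d≰′ = mono L⊆ R⊆ (last (d ∸ bound lb ∸ bound la))
    where
    eq : bound lb + (bound la + (d ∸ bound lb ∸ bound la)) ≡ d
    eq = trans (cong (bound lb +_) (m+[n∸m]≡n (<⇒≤ (≰⇒> d≰′)))) (m+[n∸m]≡n (<⇒≤ (≰⇒> d≰)))
    L⊆ : ∀ x → Low (concatenate lb la lc) d x → on U U (Low lc (d ∸ bound lb ∸ bound la)) x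
    L⊆ (in₁ x) _ = tt
    L⊆ (in₂ x) _ = tt
    L⊆ (in₃ x) lt = +-cancelˡ-< (bound la) _ _ (+-cancelˡ-< (bound lb) _ _ (subst (_ <_) (sym eq) lt))
    R⊆ : ∀ x → High (concatenate lb la lc) d x → on ∅ ∅ (High lc (d ∸ bound lb ∸ bound la)) x
    R⊆ (in₁ x) le = d≰′ (≤-trans (m≤n+o⇒m∸n≤o d (bound lb) le) (<⇒≤ (key<bound la x)))
    R⊆ (in₂ x) le = d≰ (≤-trans le (<⇒≤ (key<bound lb x)))
    R⊆ (in₃ x) le = +-cancelˡ-≤ (bound la) _ _ (+-cancelˡ-≤ (bound lb) _ _ (subst (_≤ _) (sym eq) le))

  module _ (m : Fin (n A) → Bool) where

    m̂ : Parts A B C → Bool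
    m̂ = [ m , const false ]′

    -- Seen from `B`, each vertex of `A` or `C` is either the zero column or the marked column
    -- `at b`, and the new mark vanishes on `B`. The leading zero pads the length to that of the
    -- other two cases.
    firstMarked : ∀ {L R} → Marked (adj B) (at b) L R r →
      Marked edge m̂ (on ∅ L ∅) (on U R U) (suc r)
    firstMarked {r} {L} {R} M = record
      { row = f ; col = g ; ext = 𝟎
      ; cut = λ {x} {y} → ok x y ; cut-ext = λ {x} → ok′ x }
      where
      module M = Marked M
      f g : Parts A B C → Vec Bool (suc r)
      f (in₂ x) = false ∷ M.row x
      f _ = 𝟎
      g (in₁ y) = false ∷ at a y ∙ M.ext
      g (in₂ y) = false ∷ M.col y
      g (in₃ y) = false ∷ at c y ∙ M.ext
      ok : ∀ x y → on ∅ L ∅ x → on U R U y → edge x y ≡ f x · g y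
      ok (in₂ x) (in₁ y) lx _ = M.cut-ext-∙ (at a y) lx
      ok (in₂ x) (in₂ y) lx ry = M.cut lx ry
      ok (in₂ x) (in₃ y) lx _ = M.cut-ext-∙ (at c y) lx
      ok′ : ∀ x → on ∅ L ∅ x → m̂ x ≡ f x · 𝟎
      ok′ (in₂ x) _ = sym (𝟎-·ʳ (f (in₂ x)))

    -- The triangle edges across the cut run between a subset of `a`, `b` and a subset of `a`, `c`,
    -- so one new coordinate carries them all; its entry at `a`, `a` never occurs because the sides
    -- are disjoint.
    middleMarked : ∀ {L R} → (∀ {x y} → L x → R y → x ≢ y) → Marked (adj A) m L R r →
      Marked edge m̂ (on L U ∅) (on R ∅ U) (suc r)
    middleMarked {r} {L} {R} L∩R M = record
      { row = f ; col = g ; ext = false ∷ M.ext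
      ; cut = λ {x} {y} → ok x y ; cut-ext = λ {x} → ok′ x }
      where
      module M = Marked M
      f g : Parts A B C → Vec Bool (suc r)
      f (in₁ x) = at a x ∷ M.row x
      f (in₂ x) = at b x ∷ 𝟎
      f (in₃ x) = 𝟎
      g (in₁ y) = at a y ∷ M.col y
      g (in₂ y) = 𝟎
      g (in₃ y) = at c y ∷ 𝟎
      ok : ∀ x y → on L U ∅ x → on R ∅ U y → edge x y ≡ f x · g y
      ok (in₁ x) (in₁ y) lx ry = trans (M.cut lx ry)
        (sym (cong (_xor (M.row x · M.col y)) (at-disjoint {v = a} (L∩R lx ry))))
      ok (in₁ x) (in₃ y) lx _ = sym (xor-𝟎-·ʳ (at a x ∧ at c y) (M.row x))
      ok (in₂ x) (in₁ y) _ ry = sym (xor-𝟎-·ˡ (at b x ∧ at a y) (M.col y))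
      ok (in₂ x) (in₃ y) _ _ = sym (xor-𝟎-·ˡ {r = r} (at b x ∧ at c y) 𝟎)
      ok′ : ∀ x → on L U ∅ x → m̂ x ≡ f x · (false ∷ M.ext)
      ok′ (in₁ x) lx = trans (M.cut-ext lx) (sym (cong (_xor (M.row x · M.ext)) (∧-zeroʳ (at a x))))
      ok′ (in₂ x) _ = sym (cong₂ _xor_ (∧-zeroʳ (at b x)) (𝟎-·ˡ M.ext))

    -- Here the rest of the graph is on the row side, so the factorisation for `C` is used
    -- transposed, with rows of `A` and `B` multiples of its `ext`. The new coordinate carries the
    -- mark `m`.
    lastMarked : (∀ x y → adj C x y ≡ adj C y x) → ∀ {L R} → Marked (adj C) (at c) R L r →
      Marked edge m̂ (on U U L) (on ∅ ∅ R) (suc r)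
    lastMarked {r} C-symm {L} {R} M = record
      { row = f ; col = g ; ext = true ∷ 𝟎
      ; cut = λ {x} {y} → ok x y ; cut-ext = λ {x} → ok′ x }
      where
      module M = Marked M
      f g : Parts A B C → Vec Bool (suc r)
      f (in₁ x) = m x ∷ at a x ∙ M.ext
      f (in₂ x) = false ∷ at b x ∙ M.ext
      f (in₃ x) = false ∷ M.col x
      g (in₃ y) = false ∷ M.row y
      g _ = 𝟎
      ok : ∀ x y → on U U L x → on ∅ ∅ R y → edge x y ≡ f x · g y
      ok (in₁ x) (in₃ y) _ ry = trans (M.∙-cut-ext (at a x) ry)
        (cong (_xor ((at a x ∙ M.ext) · M.row y)) (sym (∧-zeroʳ (m x))))
      ok (in₂ x) (in₃ y) _ ry = M.∙-cut-ext (at b x) ry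
      ok (in₃ x) (in₃ y) lx ry = trans (C-symm x y) (trans (M.cut ry lx) (·-comm (M.row y) (M.col x)))
      ok′ : ∀ x → on U U L x → m̂ x ≡ f x · (true ∷ 𝟎)
      ok′ (in₁ x) _ = sym (trans (cong₂ _xor_ (∧-identityʳ (m x)) (𝟎-·ʳ (at a x ∙ M.ext))) (xor-identityʳ _))
      ok′ (in₂ x) _ = sym (𝟎-·ʳ (at b x ∙ M.ext))
      ok′ (in₃ x) _ = sym (𝟎-·ʳ (M.col x))

  module _ (v : Fin (n A)) (p e : Bool) where

    -- The new coordinate pays for the row copy of `v`, whose entries are stored in the heads of the
    -- columns. The column copy, seen from `B`, is a multiple of the marked column.
    firstSplit : ∀ {L R} → Marked (adj B) (at b) L R r →
      Split edge (in₁ v) p e (on ∅ L ∅) (on U R U) (suc r)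
    firstSplit {r} {L} {R} M = record
      { row = f ; col = g ; row′ = true ∷ 𝟎 ; col′ = e ∷ (p ∧ at a v) ∙ M.ext
      ; cut = λ {x} {y} _ _ → ok x y ; cut-col = λ {x} _ → okc x
      ; cut-row = λ {y} _ _ → sym (xor-𝟎-·ˡ (p ∧ edge (in₁ v) y) (g′ y))
      ; corner = sym (xor-𝟎-·ˡ e ((p ∧ at a v) ∙ M.ext)) }
      where
      module M = Marked M
      f g : Parts A B C → Vec Bool (suc r)
      g′ : Parts A B C → Vec Bool r
      f (in₂ x) = false ∷ M.row x
      f _ = 𝟎
      g′ (in₁ y) = at a y ∙ M.ext
      g′ (in₂ y) = M.col y
      g′ (in₃ y) = at c y ∙ M.ext
      g y = (p ∧ edge (in₁ v) y) ∷ g′ y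
      ok : ∀ x y → on ∅ L ∅ x → on U R U y → edge x y ≡ f x · g y
      ok (in₂ x) (in₁ y) lx _ = M.cut-ext-∙ (at a y) lx
      ok (in₂ x) (in₂ y) lx ry = M.cut lx ry
      ok (in₂ x) (in₃ y) lx _ = M.cut-ext-∙ (at c y) lx
      okc : ∀ x → on ∅ L ∅ x → p ∧ edge x (in₁ v) ≡ f x · (e ∷ (p ∧ at a v) ∙ M.ext)
      okc (in₂ x) lx = trans
        (solve 3 (λ p s t → p :* (s :* t) := s :* (p :* t)) refl p (at b x) (at a v))
        (M.cut-ext-∙ (p ∧ at a v) lx)

    -- The pivot at the edge bc adds 1 to the rank and toggles the corner when v = a.
    middleSplit : ∀ {L R} → (∀ {x y} → L x → R y → x ≢ y) → Split (adj A) v p (e xor (p ∧ at a v)) L R r →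
      Split edge (in₁ v) p e (on L U ∅) (on R ∅ U) (suc r)
    middleSplit {r} {L} {R} L∩R M = record
      { row = f ; col = g ; row′ = q ∷ M.row′ ; col′ = q ∷ M.col′
      ; cut = λ {x} {y} → ok x y ; cut-col = λ {x} → okc x ; cut-row = λ {y} → okr y
      ; corner = trans
          (trans (solve 2 (λ e q → e := q :+ (e :+ q)) refl e q) (cong (_xor (e xor q)) (sym (∧-idem q))))
          (cong ((q ∧ q) xor_) M.corner) }
      where
      module M = Split M
      q = p ∧ at a v
      f g : Parts A B C → Vec Bool (suc r)
      f (in₁ x) = at a x ∷ M.row x
      f (in₂ x) = at b x ∷ 𝟎
      f (in₃ x) = 𝟎
      g (in₁ y) = at a y ∷ M.col y
      g (in₂ y) = 𝟎
      g (in₃ y) = at c y ∷ 𝟎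
      swap : ∀ s → p ∧ (s ∧ at a v) ≡ s ∧ q
      swap s = solve 3 (λ p s t → p :* (s :* t) := s :* (p :* t)) refl p s (at a v)
      -- A vertex other than `v` cannot be `a` when `v` is, so the new coordinate leaves the entries
      -- between `A` and the copies of `v` unchanged.
      a∧q : ∀ x → x ≢ v → at a x ∧ q ≡ false
      a∧q x x≢v = trans (sym (swap (at a x))) (trans (cong (p ∧_) (at-disjoint {v = a} x≢v)) (∧-zeroʳ p))
      ok : ∀ x y → x ≢ in₁ v → y ≢ in₁ v → on L U ∅ x → on R ∅ U y → edge x y ≡ f x · g y
      ok (in₁ x) (in₁ y) x≢ y≢ lx ry = trans (M.cut (x≢ ∘ cong in₁) (y≢ ∘ cong in₁) lx ry)
        (sym (cong (_xor (M.row x · M.col y)) (at-disjoint {v = a} (L∩R lx ry))))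
      ok (in₁ x) (in₃ y) _ _ _ _ = sym (xor-𝟎-·ʳ (at a x ∧ at c y) (M.row x))
      ok (in₂ x) (in₁ y) _ _ _ _ = sym (xor-𝟎-·ˡ (at b x ∧ at a y) (M.col y))
      ok (in₂ x) (in₃ y) _ _ _ _ = sym (xor-𝟎-·ˡ {r = r} (at b x ∧ at c y) 𝟎)
      okc : ∀ x → x ≢ in₁ v → on L U ∅ x → p ∧ edge x (in₁ v) ≡ f x · (q ∷ M.col′)
      okc (in₁ x) x≢ lx = trans (M.cut-col (x≢ ∘ cong in₁) lx)
        (cong (_xor (M.row x · M.col′)) (sym (a∧q x (x≢ ∘ cong in₁))))
      okc (in₂ x) _ _ = trans (swap (at b x)) (sym (xor-𝟎-·ˡ (at b x ∧ q) M.col′))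
      okr : ∀ y → y ≢ in₁ v → on R ∅ U y → p ∧ edge (in₁ v) y ≡ (q ∷ M.row′) · g y
      okr (in₁ y) y≢ ry = trans (M.cut-row (y≢ ∘ cong in₁) ry)
        (cong (_xor (M.row′ · M.col y)) (sym (trans (∧-comm q (at a y)) (a∧q y (y≢ ∘ cong in₁)))))
      okr (in₃ y) _ _ = trans (sym (∧-assoc p (at a v) (at c y))) (sym (xor-𝟎-·ʳ (q ∧ at c y) M.row′))

    -- Mirror image of `firstSplit`: now the column copy of `v` gets its own coordinate and the row
    -- copy is a multiple of `ext`.
    lastSplit : (∀ x y → adj C x y ≡ adj C y x) → ∀ {L R} → Marked (adj C) (at c) R L r →
      Split edge (in₁ v) p e (on U U L) (on ∅ ∅ R) (suc r)
    lastSplit {r} C-symm {L} {R} M = record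
      { row = f ; col = g ; row′ = e ∷ (p ∧ at a v) ∙ M.ext ; col′ = true ∷ 𝟎
      ; cut = λ {x} {y} _ _ → ok x y ; cut-row = λ {y} _ → okr y
      ; cut-col = λ {x} _ _ → sym (1∷𝟎 (p ∧ edge x (in₁ v)) (f′ x))
      ; corner = sym (1∷𝟎 e ((p ∧ at a v) ∙ M.ext)) }
      where
      module M = Marked M
      f g : Parts A B C → Vec Bool (suc r)
      f′ : Parts A B C → Vec Bool r
      f′ (in₁ x) = at a x ∙ M.ext
      f′ (in₂ x) = at b x ∙ M.ext
      f′ (in₃ x) = M.col x
      f x = (p ∧ edge x (in₁ v)) ∷ f′ x
      g (in₃ y) = false ∷ M.row y
      g _ = 𝟎
      1∷𝟎 : ∀ β (z : Vec Bool r) → (β ∷ z) · (true ∷ 𝟎) ≡ β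
      1∷𝟎 β z = trans (xor-𝟎-·ʳ (β ∧ true) z) (∧-identityʳ β)
      0∷ : ∀ β (z w : Vec Bool r) → (β ∷ z) · (false ∷ w) ≡ z · w
      0∷ β z w = cong (_xor (z · w)) (∧-zeroʳ β)
      ok′ : ∀ x y → on U U L x → R y → edge x (in₃ y) ≡ f′ x · M.row y
      ok′ (in₁ x) y _ ry = M.∙-cut-ext (at a x) ry
      ok′ (in₂ x) y _ ry = M.∙-cut-ext (at b x) ry
      ok′ (in₃ x) y lx ry = trans (C-symm x y) (trans (M.cut ry lx) (·-comm (M.row y) (M.col x)))
      ok : ∀ x y → on U U L x → on ∅ ∅ R y → edge x y ≡ f x · g y
      ok x (in₃ y) lx ry = trans (ok′ x y lx ry) (sym (0∷ (p ∧ edge x (in₁ v)) (f′ x) (M.row y)))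
      okr : ∀ y → on ∅ ∅ R y → p ∧ edge (in₁ v) y ≡ (e ∷ (p ∧ at a v) ∙ M.ext) · g y
      okr (in₃ y) ry = trans (sym (∧-assoc p (at a v) (at c y)))
        (trans (M.∙-cut-ext (p ∧ at a v) ry) (sym (0∷ e ((p ∧ at a v) ∙ M.ext) (M.row y))))

-- Local complementation of split cut matrices

transpose : ∀ {V} {E : V → V → Bool} → (∀ x y → E x y ≡ E y x) → ∀ {v p e L R} →
  Split E v p e L R r → Split E v p e R L r
transpose E-symm {p = p} M = record
  { row = M.col ; col = M.row ; row′ = M.col′ ; col′ = M.row′
  ; cut = λ x≢ y≢ rx ly → trans (E-symm _ _) (trans (M.cut y≢ x≢ ly rx) (·-comm (M.row _) _))
  ; cut-col = λ x≢ rx → trans (cong (p ∧_) (E-symm _ _)) (trans (M.cut-row x≢ rx) (·-comm M.row′ _))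
  ; cut-row = λ y≢ ly → trans (cong (p ∧_) (E-symm _ _)) (trans (M.cut-col y≢ ly) (·-comm (M.row _) _))
  ; corner = trans M.corner (·-comm M.row′ _) }
  where module M = Split M

*-offdiag : ∀ G w {x y} → x ≢ y → adj (G * w) x y ≡ adj G x y xor (adj G x w ∧ adj G y w)
*-offdiag G w {x} {y} x≢y = cong (λ d → adj G x y xor (not d ∧ (adj G x w ∧ adj G y w))) (dec-false (x ≟ y) x≢y)

*-simple : ∀ {G} → Simple G → ∀ w → Simple (G * w)
*-simple {G} S w = record { symm = symm′ ; irr = λ x → trans
    (cong (λ d → adj G x x xor (not d ∧ (adj G x w ∧ adj G x w))) (dec-true (x ≟ x) refl))
    (trans (xor-identityʳ _) (irr x)) }
  where
  open Simple S
  symm′ : ∀ x y → adj (G * w) x y ≡ adj (G * w) y x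
  symm′ x y with x ≟ y
  ... | yes refl rewrite dec-true (x ≟ x) refl = refl
  ... | no x≢y rewrite dec-false (y ≟ x) (x≢y ∘ sym) =
    cong₂ _xor_ (symm x y) (∧-comm (adj G x w) (adj G y w))

module LocalComplement (G : Graph) (S : Simple G) where
  open Simple S

  -- Across the cut, complementing at `w` adds row `w` to the rows of its neighbours. If the copies
  -- of `v` are adjacent to `w`, the edge between them is toggled too, which accounts for the corner
  -- in the hypothesis.
  complement-low : ∀ w {v p e L R} → w ≢ v → (∀ {x y} → L x → R y → x ≢ y) → L w →
    Split (adj G) v p (e xor (p ∧ adj G v w)) L R r → Split (adj (G * w)) v p e L R r
  complement-low w {v} {p} {e} {L} {R} w≢v L∩R lw M = record
    { row = λ x → M.row x +[ adj G x w ] M.row w ; col = M.col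
    ; row′ = M.row′ +[ p ∧ adj G v w ] M.row w ; col′ = M.col′
    ; cut = λ {x} {y} x≢ y≢ lx ry → trans (*-offdiag G w (L∩R lx ry)) (sym (trans
        (+[]-·ˡ (M.row x) _ _ _)
        (cong₂ (λ s t → s xor (adj G x w ∧ t)) (sym (M.cut x≢ y≢ lx ry))
          (trans (sym (M.cut w≢v y≢ lw ry)) (symm w y)))))
    ; cut-col = λ {x} x≢ lx → trans (cong (p ∧_) (*-offdiag G w x≢)) (sym (trans
        (+[]-·ˡ (M.row x) _ _ _)
        (trans (cong₂ (λ s t → s xor (adj G x w ∧ t)) (sym (M.cut-col x≢ lx))
            (trans (sym (M.cut-col w≢v lw)) (cong (p ∧_) (symm w v))))
          (solve 4 (λ p s t u → p :* s :+ t :* (p :* u) := p :* (s :+ t :* u))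
            refl p (adj G x v) (adj G x w) (adj G v w)))))
    ; cut-row = λ {y} y≢ ry → trans (cong (p ∧_) (*-offdiag G w (y≢ ∘ sym))) (sym (trans
        (+[]-·ˡ M.row′ _ _ _)
        (trans (cong₂ (λ s t → s xor ((p ∧ adj G v w) ∧ t)) (sym (M.cut-row y≢ ry))
            (trans (sym (M.cut w≢v y≢ lw ry)) (symm w y)))
          (solve 4 (λ p s t u → p :* s :+ (p :* t) :* u := p :* (s :+ t :* u))
            refl p (adj G v y) (adj G v w) (adj G y w)))))
    ; corner = sym (trans (+[]-·ˡ M.row′ _ _ _) (trans
        (cong₂ (λ s t → s xor ((p ∧ adj G v w) ∧ t)) (sym M.corner)
          (trans (sym (M.cut-col w≢v lw)) (cong (p ∧_) (symm w v))))
        (trans (cong ((e xor (p ∧ adj G v w)) xor_) (∧-idem (p ∧ adj G v w)))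
          (solve 2 (λ e q → (e :+ q) :+ q := e) refl e (p ∧ adj G v w))))) }
    where module M = Split M

  complement-other : ∀ w {v p e L R} → w ≢ v → (∀ {x y} → L x → R y → x ≢ y) → L w ⊎ R w →
    Split (adj G) v p (e xor (p ∧ adj G v w)) L R r → Split (adj (G * w)) v p e L R r
  complement-other w w≢v L∩R (inj₁ lw) M = complement-low w w≢v L∩R lw M
  complement-other w w≢v L∩R (inj₂ rw) M = transpose (Simple.symm (*-simple S w))
    (complement-low w w≢v (λ rx ly eq → L∩R ly rx (sym eq)) rw (transpose symm M))

  module _ {v : Fin (n G)} {L R : Fin (n G) → Set} (L∩R : ∀ {x y} → L x → R y → x ≢ y) where

    private
      col-v : ∀ x → x ≢ v → adj (G * v) x v ≡ adj G x v
      col-v x x≢v = trans (*-offdiag G v x≢v) (trans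
        (cong (λ t → adj G x v xor (adj G x v ∧ t)) (irr v))
        (trans (cong (adj G x v xor_) (∧-zeroʳ (adj G x v))) (xor-identityʳ _)))
      row-v : ∀ y → y ≢ v → adj (G * v) v y ≡ adj G v y
      row-v y y≢v = trans (Simple.symm (*-simple S v) v y) (trans (col-v y y≢v) (symm y v))
      xor-not : ∀ p a → (not p ∧ a) xor (a ∧ true) ≡ p ∧ a
      xor-not true  a = ∧-identityʳ a
      xor-not false true = refl
      xor-not false false = refl

    -- One copy's row is added to the rows of the neighbours of `v`, the other's column to their
    -- columns. The corner 1 produces the complementing term and flips `p`; the two terms with
    -- `not p` cancel.
    complement-self-true : ∀ {p} → Split (adj G) v (not p) true L R r → Split (adj (G * v)) v p true L R r
    complement-self-true {p = p} M = record
      { row = λ x → M.row x +[ adj G x v ] M.row′ ; col = λ y → M.col y +[ adj G v y ] M.col′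
      ; row′ = M.row′ ; col′ = M.col′
      ; cut = λ {x} {y} x≢ y≢ lx ry → trans (*-offdiag G v (L∩R lx ry)) (trans
          (cong (λ t → adj G x y xor (adj G x v ∧ t)) (symm y v))
          (sym (trans (+[]-·ˡ (M.row x) _ _ _) (trans
            (cong₂ (λ s t → s xor (adj G x v ∧ t))
              (trans (+[]-·ʳ (M.row x) (M.col y) (adj G v y) M.col′)
                (cong₂ (λ s t → s xor (adj G v y ∧ t)) (sym (M.cut x≢ y≢ lx ry)) (sym (M.cut-col x≢ lx))))
              (trans (+[]-·ʳ M.row′ (M.col y) (adj G v y) M.col′)
                (cong₂ (λ s t → s xor (adj G v y ∧ t)) (sym (M.cut-row y≢ ry)) (sym M.corner))))
            (trans (cong (λ t → (adj G x y xor (adj G v y ∧ (not p ∧ adj G x v))) xor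
                                (adj G x v ∧ ((not p ∧ adj G v y) xor t))) (∧-identityʳ (adj G v y)))
              (solve 4 (λ A a b q → (A :+ b :* (q :* a)) :+ a :* (q :* b :+ b) := A :+ a :* b)
                refl (adj G x y) (adj G x v) (adj G v y) (not p)))))))
      ; cut-col = λ {x} x≢ lx → trans (cong (p ∧_) (col-v x x≢)) (sym (trans (+[]-·ˡ (M.row x) _ _ _)
          (trans (cong₂ (λ s t → s xor (adj G x v ∧ t)) (sym (M.cut-col x≢ lx)) (sym M.corner)) (xor-not p _))))
      ; cut-row = λ {y} y≢ ry → trans (cong (p ∧_) (row-v y y≢)) (sym (trans (+[]-·ʳ M.row′ (M.col y) _ _)
          (trans (cong₂ (λ s t → s xor (adj G v y ∧ t)) (sym (M.cut-row y≢ ry)) (sym M.corner)) (xor-not p _))))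
      ; corner = M.corner }
      where module M = Split M

    -- Adding `row′` to the rows of the neighbours of `v` already produces the complementing term,
    -- and the corner 0 leaves the column copy as it was.
    complement-self-false : Split (adj G) v true false L R r → Split (adj (G * v)) v true false L R r
    complement-self-false M = record
      { row = λ x → M.row x +[ adj G x v ] M.row′ ; col = M.col ; row′ = M.row′ ; col′ = M.col′
      ; cut = λ {x} {y} x≢ y≢ lx ry → trans (*-offdiag G v (L∩R lx ry)) (trans
          (cong (λ t → adj G x y xor (adj G x v ∧ t)) (symm y v))
          (sym (trans (+[]-·ˡ (M.row x) _ _ _)
            (cong₂ (λ s t → s xor (adj G x v ∧ t)) (sym (M.cut x≢ y≢ lx ry)) (sym (M.cut-row y≢ ry))))))
      ; cut-col = λ {x} x≢ lx → trans (col-v x x≢) (sym (trans (+[]-·ˡ (M.row x) _ _ _)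
          (trans (cong₂ (λ s t → s xor (adj G x v ∧ t)) (sym (M.cut-col x≢ lx)) (sym M.corner))
            (trans (cong (adj G x v xor_) (∧-zeroʳ (adj G x v))) (xor-identityʳ _)))))
      ; cut-row = λ {y} y≢ ry → trans (row-v y y≢) (M.cut-row y≢ ry)
      ; corner = M.corner }
      where module M = Split M

Low∩High : ∀ {V} (l : Arrangement V) d {x y} → Low l d x → High l d y → x ≢ y
Low∩High l d lx hy refl = <⇒≱ lx hy

Low∪High : ∀ {V} (l : Arrangement V) d x → Low l d x ⊎ High l d x
Low∪High l d x with key l x <? d
... | yes lt = inj₁ lt
... | no  ge = inj₂ (≮⇒≥ ge)

-- The condition `p ∨ e` leaves three types. All are carried through the induction, since pivoting
-- and local complementation exchange them; the arrangement may depend on the vertex and the type.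
AllSplit : Graph → ℕ → Set
AllSplit G r = ∀ v p e → p ∨ e ≡ true →
  Σ (Arrangement (Fin (n G))) λ l → ∀ d → Split (adj G) v p e (Low l d) (High l d) r

nonzero : ∀ p {e} b → p ∨ e ≡ true → p ∨ (e xor (p ∧ b)) ≡ true
nonzero true         _ _ = refl
nonzero false {true} _ _ = refl

-- Local complementation permutes the three types of splitting.
*-AllSplit : ∀ {G} → Simple G → ∀ w → AllSplit G r → AllSplit (G * w) r
*-AllSplit {G = G} S w all v p e ok with w ≟ v
... | no w≢v = let l , sp = all v p (e xor (p ∧ adj G v w)) (nonzero p (adj G v w) ok) in
  l , λ d → complement-other w w≢v (Low∩High l d) (Low∪High l d w) (sp d)
  where
  open LocalComplement G S
... | yes refl = self p e ok
  where
  open LocalComplement G S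
  self : ∀ p e → p ∨ e ≡ true →
    Σ (Arrangement (Fin (n G))) λ l → ∀ d → Split (adj (G * w)) w p e (Low l d) (High l d) _
  self true true _ =
    let l , sp = all w false true refl in l , λ d → complement-self-true (Low∩High l d) (sp d)
  self true false _ =
    let l , sp = all w true false refl in l , λ d → complement-self-false (Low∩High l d) (sp d)
  self false true _ =
    let l , sp = all w true true refl in l , λ d → complement-self-true (Low∩High l d) (sp d)

-- Vertex-minors with one vertex fewer

-- Keeping v around lets local complementations made after the deletion be performed
-- in the whole graph.
record Deletion (K : Graph) (r : ℕ) : Set where
  field
    whole   : Graph
    simple  : Simple whole
    v       : Fin (n whole)
    arr     : Arrangement (Fin (n whole))
    split   : ∀ d → Split (adj whole) v false true (Low arr d) (High arr d) r
    emb     : Fin (n K) → Fin (n whole)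
    emb-inj : Injective _≡_ _≡_ emb
    emb-≢   : ∀ x → emb x ≢ v
    pres    : ∀ x y → adj K x y ≡ adj whole (emb x) (emb y)

at-cong : ∀ {m m′} {φ : Fin m → Fin m′} → Injective _≡_ _≡_ φ → ∀ v x → at v x ≡ at (φ v) (φ x)
at-cong {φ = φ} φ-inj v x with x ≟ v
... | yes refl = sym (at-refl (φ v))
... | no x≢v = sym (dec-false (φ x ≟ φ v) (x≢v ∘ φ-inj))

-- Complementing `whole` at `emb w` induces the complementation of `K` at `w`. As `p` is `false`,
-- the corner keeps its value.
*-Deletion : ∀ {K} w → Deletion K r → Deletion (K * w) r
*-Deletion {K = K} w D = record
  { whole = whole * emb w ; simple = *-simple simple (emb w) ; v = v ; arr = arr
  ; split = λ d → complement-other (emb w) (emb-≢ w) (Low∩High arr d) (Low∪High arr d (emb w)) (split d)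
  ; emb = emb ; emb-inj = emb-inj ; emb-≢ = emb-≢
  ; pres = λ x y → cong₂ _xor_ (pres x y)
      (cong₂ _∧_ (cong not (at-cong emb-inj y x)) (cong₂ _∧_ (pres x w) (pres y w))) }
  where
  open Deletion D
  open LocalComplement whole simple

Iso-inj : ∀ {H G} (i : Iso H G) → Injective _≡_ _≡_ (Iso.to i)
Iso-inj i {x} {y} eq = trans (sym (Iso.from-to i x)) (trans (cong (Iso.from i) eq) (Iso.from-to i y))

Deletion-Iso : ∀ {H K} → Iso H K → Deletion K r → Deletion H r
Deletion-Iso i D = record
  { whole = whole ; simple = simple ; v = v ; arr = arr ; split = split
  ; emb = emb ∘ Iso.to i ; emb-inj = Iso-inj i ∘ emb-inj ; emb-≢ = λ x → emb-≢ (Iso.to i x)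
  ; pres = λ x y → trans (Iso.pres i x y) (pres _ _) }
  where open Deletion D

-- The isolated edge between the two copies of v uses up one of the k + 1 dimensions.
Deletion-thin : ∀ {K} → Deletion K (suc k) → KeyLRWLE K k
Deletion-thin {k = k} {K = K} D = key arr ∘ emb , emb-inj ∘ key-inj arr , thin
  where
  open Deletion D
  thin : ∀ c → ¬ CutRankGE K (λ x → key arr (emb x) < c) (suc k)
  thin c (f , f∈X , ind) = let
      S , ne , dep = dependent vs
      -- Testing against `col′` isolates the coefficient of `row′`: the corner is 1 and, `p` being
      -- `false`, all other entries of that column vanish. The dependence is therefore among the
      -- rows of `K`.
      S₀≡false = trans (sym (trans (cong₂ _xor_ (trans (cong (S zero ∧_) (sym corner)) (∧-identityʳ _))
        (parity-false λ i → trans (cong (S (suc i) ∧_) (sym (cut-col (emb-≢ _) (f∈X i)))) (∧-zeroʳ _)))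
        (xor-identityʳ _))) (dep col′)
      y , y∉X , odd = ind (S ∘ suc) (later S ne S₀≡false)
    in contradiction (trans (sym odd) (trans
      (sym (cong₂ _xor_ (trans (cong (S zero ∧_) (sym (cut-row (emb-≢ y) (≮⇒≥ y∉X)))) (∧-zeroʳ _))
        (parity-cong λ i → cong (S (suc i) ∧_) (sym (trans (pres (f i) y)
          (cut (emb-≢ _) (emb-≢ y) (f∈X i) (≮⇒≥ y∉X)))))))
      (dep (col (emb y))))) λ ()
    where
    open Split (split c)
    vs : Fin (suc (suc k)) → Vec Bool (suc k)
    vs zero = row′
    vs (suc i) = row (emb (f i))
    later : (S : Fin (suc (suc k)) → Bool) → (∃ λ i → S i ≡ true) → S zero ≡ false → ∃ λ i → S (suc i) ≡ true
    later S (zero  , eq) S₀ = contradiction (trans (sym eq) S₀) λ ()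
    later S (suc i , eq) _  = i , eq

─-size : ∀ G v → suc (n (G ─ v)) ≡ n G
─-size (mkGraph (suc _) _) v = refl

VertexMinor-size : ∀ {H G} → VertexMinor H G → n H ≤ n G
VertexMinor-size (vm-iso i) = injective⇒≤ (Iso-inj i)
VertexMinor-size (vm-lc v vm) = VertexMinor-size vm
VertexMinor-size (vm-del {G} v vm) =
  ≤-trans (VertexMinor-size vm) (≤-trans (n≤1+n _) (≤-reflexive (─-size G v)))

-- Equal sizes leave no room for another deletion, so only local complementations and the final
-- isomorphism remain.
minor-Deletion : ∀ {H K} → VertexMinor H K → n H ≡ n K → Deletion K r → Deletion H r
minor-Deletion (vm-iso i) _ D = Deletion-Iso i D
minor-Deletion (vm-lc v vm) eq D = minor-Deletion vm eq (*-Deletion v D)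
minor-Deletion (vm-del {K} v vm) eq D =
  contradiction (≤-trans (≤-reflexive (trans (─-size K v) (sym eq))) (VertexMinor-size vm)) 1+n≰n

delete : ∀ G (v : Fin (n G)) → Simple G → AllSplit G r → Deletion (G ─ v) r
delete (mkGraph (suc m) a) v S all = record
  { whole = mkGraph (suc m) a ; simple = S ; v = v
  ; arr = proj₁ (all v false true refl) ; split = proj₂ (all v false true refl)
  ; emb = punchIn v ; emb-inj = punchIn-injective v _ _ ; emb-≢ = punchInᵢ≢i v ; pres = λ _ _ → refl }

-- The sizes force exactly one deletion. Before it `AllSplit` survives each local complementation;
-- at the deletion of `v` the type with `p` false and `e` true is selected.
minor-AllSplit : ∀ {H G} → VertexMinor H G → suc (n H) ≡ n G → Simple G → AllSplit G r → Deletion H r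
minor-AllSplit {H = H} (vm-iso i) eq S all =
  contradiction (≤-trans (≤-reflexive eq) (injective⇒≤ {f = Iso.from i} from-inj)) 1+n≰n
  where
  from-inj : Injective _≡_ _≡_ (Iso.from i)
  from-inj {x} {y} e = trans (sym (Iso.to-from i x)) (trans (cong (Iso.to i) e) (Iso.to-from i y))
minor-AllSplit (vm-lc v vm) eq S all = minor-AllSplit vm eq (*-simple S v) (*-AllSplit S v all)
minor-AllSplit (vm-del {G} v vm) eq S all = minor-Deletion vm
  (suc-injective (trans eq (sym (─-size G v)))) (delete G v S all)

-- Delta compositions up to isomorphism and their symmetry

record Delta (G A B C : Graph) (a : Fin (n A)) (b : Fin (n B)) (c : Fin (n C)) : Set where
  open Edge A B C a b c using (edge)
  field
    to      : Fin (n G) → Parts A B C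
    from    : Parts A B C → Fin (n G)
    to-from : ∀ y → to (from y) ≡ y
    from-to : ∀ x → from (to x) ≡ x
    pres    : ∀ x y → adj G x y ≡ edge (to x) (to y)

  to-inj : Injective _≡_ _≡_ to
  to-inj {x} {y} eq = trans (sym (from-to x)) (trans (cong from eq) (from-to y))

  from-inj : Injective _≡_ _≡_ from
  from-inj {x} {y} eq = trans (sym (to-from x)) (trans (cong to eq) (to-from y))

  pres-from : ∀ x y → adj G (from x) (from y) ≡ edge x y
  pres-from x y = trans (pres _ _) (cong₂ edge (to-from x) (to-from y))

unpart : ∀ {a b c} → Fin a ⊎ (Fin b ⊎ Fin c) → Fin (a + (b + c))
unpart {a} {b} {c} (in₁ x) = x ↑ˡ (b + c)
unpart {a} {b} {c} (in₂ x) = a ↑ʳ (x ↑ˡ c)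
unpart {a} {b} {c} (in₃ x) = a ↑ʳ (b ↑ʳ x)

part-unpart : ∀ {a b c} (z : Fin a ⊎ (Fin b ⊎ Fin c)) → part {a} (unpart z) ≡ z
part-unpart {a} {b} {c} (in₁ x) rewrite splitAt-↑ˡ a x (b + c) = refl
part-unpart {a} {b} {c} (in₂ x) rewrite splitAt-↑ʳ a (b + c) (x ↑ˡ c) | splitAt-↑ˡ b x c = refl
part-unpart {a} {b} {c} (in₃ x) rewrite splitAt-↑ʳ a (b + c) (b ↑ʳ x) | splitAt-↑ʳ b c x = refl

unpart-part : ∀ {a b c} (x : Fin (a + (b + c))) → unpart (part {a} {b} x) ≡ x
unpart-part {a} {b} {c} x with splitAt a {b + c} x in eq
... | inj₁ p = splitAt⁻¹-↑ˡ eq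
... | inj₂ q with splitAt b {c} q in eq′
...   | inj₁ s = trans (cong (a ↑ʳ_) (splitAt⁻¹-↑ˡ eq′)) (splitAt⁻¹-↑ʳ {a} eq)
...   | inj₂ s = trans (cong (a ↑ʳ_) (splitAt⁻¹-↑ʳ {b} eq′)) (splitAt⁻¹-↑ʳ {a} eq)

Iso⇒Delta : ∀ {G A B C a b c} → Iso G (deltaComp A B C a b c) → Delta G A B C a b c
Iso⇒Delta {G} {A} {B} {C} {a} {b} {c} i = record
  { to = part ∘ Iso.to i ; from = Iso.from i ∘ unpart
  ; to-from = λ y → trans (cong part (Iso.to-from i (unpart y))) (part-unpart y)
  ; from-to = λ x → trans (cong (Iso.from i) (unpart-part {n A} {n B} (Iso.to i x))) (Iso.from-to i x)
  ; pres = λ x y → trans (Iso.pres i x y) (edge≡ (Iso.to i x) (Iso.to i y)) }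
  where
  open Edge A B C a b c
  edge≡ : ∀ x y → adj (deltaComp A B C a b c) x y ≡ edge (part x) (part y)
  edge≡ x y with part {n A} {n B} {n C} x | part {n A} {n B} {n C} y
  ... | in₁ _ | in₁ _ = refl
  ... | in₁ _ | in₂ _ = refl
  ... | in₁ _ | in₃ _ = refl
  ... | in₂ _ | in₁ _ = refl
  ... | in₂ _ | in₂ _ = refl
  ... | in₂ _ | in₃ _ = refl
  ... | in₃ _ | in₁ _ = refl
  ... | in₃ _ | in₂ _ = refl
  ... | in₃ _ | in₃ _ = refl

σ₁₂ : ∀ {X Y Z : Set} → X ⊎ (Y ⊎ Z) → Y ⊎ (X ⊎ Z)
σ₁₂ (in₁ x) = in₂ x
σ₁₂ (in₂ x) = in₁ x
σ₁₂ (in₃ x) = in₃ x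

σ₁₃ : ∀ {X Y Z : Set} → X ⊎ (Y ⊎ Z) → Z ⊎ (Y ⊎ X)
σ₁₃ (in₁ x) = in₃ x
σ₁₃ (in₂ x) = in₂ x
σ₁₃ (in₃ x) = in₁ x

module _ {G A B C a b c} (D : Delta G A B C a b c) where
  open Delta D

  private
    inv₁₂ : ∀ {X Y Z : Set} (z : X ⊎ (Y ⊎ Z)) → σ₁₂ (σ₁₂ z) ≡ z
    inv₁₂ (in₁ x) = refl
    inv₁₂ (in₂ x) = refl
    inv₁₂ (in₃ x) = refl

    inv₁₃ : ∀ {X Y Z : Set} (z : X ⊎ (Y ⊎ Z)) → σ₁₃ (σ₁₃ z) ≡ z
    inv₁₃ (in₁ x) = refl
    inv₁₃ (in₂ x) = refl
    inv₁₃ (in₃ x) = refl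

    open Edge A B C a b c using (edge)
    edge₁₂ : ∀ x y → edge x y ≡ Edge.edge B A C b a c (σ₁₂ x) (σ₁₂ y)
    edge₁₂ (in₁ _) (in₁ _) = refl
    edge₁₂ (in₁ _) (in₂ _) = refl
    edge₁₂ (in₁ _) (in₃ _) = refl
    edge₁₂ (in₂ _) (in₁ _) = refl
    edge₁₂ (in₂ _) (in₂ _) = refl
    edge₁₂ (in₂ _) (in₃ _) = refl
    edge₁₂ (in₃ _) (in₁ _) = refl
    edge₁₂ (in₃ _) (in₂ _) = refl
    edge₁₂ (in₃ _) (in₃ _) = refl

    edge₁₃ : ∀ x y → edge x y ≡ Edge.edge C B A c b a (σ₁₃ x) (σ₁₃ y)
    edge₁₃ (in₁ _) (in₁ _) = refl
    edge₁₃ (in₁ _) (in₂ _) = refl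
    edge₁₃ (in₁ _) (in₃ _) = refl
    edge₁₃ (in₂ _) (in₁ _) = refl
    edge₁₃ (in₂ _) (in₂ _) = refl
    edge₁₃ (in₂ _) (in₃ _) = refl
    edge₁₃ (in₃ _) (in₁ _) = refl
    edge₁₃ (in₃ _) (in₂ _) = refl
    edge₁₃ (in₃ _) (in₃ _) = refl

  -- The swaps let the upper bound assume that the chosen vertex lies in the first part, and the
  -- lower bound that the median cut belongs to the second.
  swap₁₂ : Delta G B A C b a c
  swap₁₂ = record
    { to = σ₁₂ ∘ to ; from = from ∘ σ₁₂
    ; to-from = λ y → trans (cong σ₁₂ (to-from (σ₁₂ y))) (inv₁₂ y)
    ; from-to = λ x → trans (cong from (inv₁₂ (to x))) (from-to x)
    ; pres = λ x y → trans (pres x y) (edge₁₂ (to x) (to y)) }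

  swap₁₃ : Delta G C B A c b a
  swap₁₃ = record
    { to = σ₁₃ ∘ to ; from = from ∘ σ₁₃
    ; to-from = λ y → trans (cong σ₁₃ (to-from (σ₁₃ y))) (inv₁₃ y)
    ; from-to = λ x → trans (cong from (inv₁₃ (to x))) (from-to x)
    ; pres = λ x y → trans (pres x y) (edge₁₃ (to x) (to y)) }

swap₂₃ : ∀ {G A B C a b c} → Delta G A B C a b c → Delta G A C B a c b
swap₂₃ D = swap₁₂ (swap₁₃ (swap₁₂ D))

Delta⇒simple : ∀ {G A B C a b c} → Simple A → Simple B → Simple C → Delta G A B C a b c → Simple G
Delta⇒simple {A = A} {B} {C} {a} {b} {c} SA SB SC D = record
  { symm = λ x y → trans (pres x y) (trans (edge-symm (to x) (to y)) (sym (pres y x)))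
  ; irr = λ x → trans (pres x x) (edge-irr (to x)) }
  where
  open Delta D
  open Edge A B C a b c
  open Simple
  edge-symm : ∀ x y → edge x y ≡ edge y x
  edge-symm (in₁ x) (in₁ y) = symm SA x y
  edge-symm (in₁ x) (in₂ y) = ∧-comm (at a x) (at b y)
  edge-symm (in₁ x) (in₃ y) = ∧-comm (at a x) (at c y)
  edge-symm (in₂ x) (in₁ y) = ∧-comm (at b x) (at a y)
  edge-symm (in₂ x) (in₂ y) = symm SB x y
  edge-symm (in₂ x) (in₃ y) = ∧-comm (at b x) (at c y)
  edge-symm (in₃ x) (in₁ y) = ∧-comm (at c x) (at a y)
  edge-symm (in₃ x) (in₂ y) = ∧-comm (at c x) (at b y)
  edge-symm (in₃ x) (in₃ y) = symm SC x y
  edge-irr : ∀ x → edge x x ≡ false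
  edge-irr (in₁ x) = irr SA x
  edge-irr (in₂ x) = irr SB x
  edge-irr (in₃ x) = irr SC x

K₂-symm : ∀ x y → adj K₂ x y ≡ adj K₂ y x
K₂-symm zero zero = refl
K₂-symm zero (suc zero) = refl
K₂-symm (suc zero) zero = refl
K₂-symm (suc zero) (suc zero) = refl

InDelta⇒simple : ∀ {G} → InDelta k G → Simple G
InDelta⇒simple (Δ-base i) = record
  { symm = λ x y → trans (Iso.pres i x y) (trans (K₂-symm (Iso.to i x) (Iso.to i y)) (sym (Iso.pres i y x)))
  ; irr = λ x → trans (Iso.pres i x x) (cong not (at-refl (Iso.to i x))) }
InDelta⇒simple (Δ-comp A B C _ _ _ i) =
  Delta⇒simple (InDelta⇒simple A) (InDelta⇒simple B) (InDelta⇒simple C) (Iso⇒Delta i)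

-- Arrangements of the graphs in Δ_k

-- The column `at v` is that of a pendant vertex at `v` placed after all other vertices.
AllMarked : Graph → ℕ → Set
AllMarked G r = ∀ v → Σ (Arrangement (Fin (n G))) λ l → ∀ d → Marked (adj G) (at v) (Low l d) (High l d) r

-- Reversal puts the pendant vertex in front, as is needed for the part `C`, which the rest of the
-- graph precedes.
reverseMarked : ∀ {V} {E : V → V → Bool} {m} →
  (Σ (Arrangement V) λ l → ∀ d → Marked E m (Low l d) (High l d) r) →
  Σ (Arrangement V) λ l → ∀ d → Marked E m (High l d) (Low l d) r
reverseMarked (l , M) = reverse l , λ d → pullMarked (λ _ _ → refl) (λ _ → refl)
  (λ _ → reverse-High l d) (λ _ → reverse-Low l d) (M (bound l ∸ d))

-- The vertex `v` comes last.
K₂-arr : Fin 2 → Arrangement (Fin 2)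
K₂-arr v = record { key = K v ; bound = 2 ; key<bound = K<2 v ; key-inj = K-inj v _ _ }
  where
  K : Fin 2 → Fin 2 → ℕ
  K zero       zero       = 1
  K zero       (suc zero) = 0
  K (suc zero) zero       = 0
  K (suc zero) (suc zero) = 1
  K<2 : ∀ v x → K v x < 2
  K<2 zero       zero       = s≤s (s≤s z≤n)
  K<2 zero       (suc zero) = s≤s z≤n
  K<2 (suc zero) zero       = s≤s z≤n
  K<2 (suc zero) (suc zero) = s≤s (s≤s z≤n)
  K-inj : ∀ v x y → K v x ≡ K v y → x ≡ y
  K-inj zero       zero       zero       _ = refl
  K-inj zero       zero       (suc zero) ()
  K-inj zero       (suc zero) (suc zero) _ = refl
  K-inj (suc zero) zero       zero       _ = refl
  K-inj (suc zero) zero       (suc zero) ()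
  K-inj (suc zero) (suc zero) (suc zero) _ = refl

K₂-arr-last : ∀ v {x} → x ≢ v → key (K₂-arr v) x ≡ 0
K₂-arr-last zero       {zero}     x≢ = contradiction refl x≢
K₂-arr-last zero       {suc zero} x≢ = refl
K₂-arr-last (suc zero) {zero}     x≢ = refl
K₂-arr-last (suc zero) {suc zero} x≢ = contradiction refl x≢

K₂-AllMarked : AllMarked K₂ 1
K₂-AllMarked v = K₂-arr v , M v
  where
  M : ∀ v d → Marked (adj K₂) (at v) (Low (K₂-arr v) d) (High (K₂-arr v) d) 1
  M v zero = record { row = λ _ → 𝟎 ; col = λ _ → 𝟎 ; ext = 𝟎 ; cut = λ () ; cut-ext = λ () }
  M v (suc zero) = record
    { row = λ _ → true ∷ [] ; col = λ _ → true ∷ [] ; ext = 𝟎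
    ; cut = λ {x} {y} → cut v x y ; cut-ext = λ {x} → ext v x }
    where
    cut : ∀ v x y → Low (K₂-arr v) 1 x → High (K₂-arr v) 1 y → adj K₂ x y ≡ true
    cut zero       (suc zero) zero       _ _ = refl
    cut (suc zero) zero       (suc zero) _ _ = refl
    cut zero       zero       _          (s≤s ()) _
    cut (suc zero) (suc zero) _          (s≤s ()) _
    cut zero       (suc zero) (suc zero) _ ()
    cut (suc zero) zero       zero       _ ()
    ext : ∀ v x → Low (K₂-arr v) 1 x → at v x ≡ false
    ext zero       (suc zero) _ = refl
    ext (suc zero) zero       _ = refl
    ext zero       zero       (s≤s ())
    ext (suc zero) (suc zero) (s≤s ())
  M v (suc (suc d)) = record
    { row = λ x → at v x ∷ [] ; col = λ _ → 𝟎 ; ext = true ∷ []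
    ; cut = λ {x} {y} _ hy → contradiction (key<bound (K₂-arr v) y) (≤⇒≯ (≤-trans (s≤s (s≤s z≤n)) hy))
    ; cut-ext = λ {x} _ → sym (trans (xor-identityʳ _) (∧-identityʳ (at v x))) }

-- Apart from `v` there is one vertex, so one side of each cut consists of a copy of `v` alone and
-- the matrix has a single row or column.
K₂-AllSplit : AllSplit K₂ 1
K₂-AllSplit v p e _ = K₂-arr v , M
  where
  M : ∀ d → Split (adj K₂) v p e (Low (K₂-arr v) d) (High (K₂-arr v) d) 1
  M zero = record
    { row = λ _ → 𝟎 ; col = λ y → (p ∧ adj K₂ v y) ∷ [] ; row′ = true ∷ [] ; col′ = e ∷ []
    ; cut = λ _ _ () ; cut-col = λ _ () ; cut-row = λ _ _ → sym (xor-identityʳ _)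
    ; corner = sym (xor-identityʳ _) }
  M (suc d) = record
    { row = λ x → (p ∧ adj K₂ x v) ∷ [] ; col = λ _ → 𝟎 ; row′ = e ∷ [] ; col′ = true ∷ []
    ; cut = λ _ y≢ _ hy → none y≢ hy
    ; cut-col = λ _ _ → sym (trans (xor-identityʳ _) (∧-identityʳ _))
    ; cut-row = λ y≢ hy → none y≢ hy
    ; corner = sym (trans (xor-identityʳ _) (∧-identityʳ _)) }
    where
    none : ∀ {y} {X : Set} → y ≢ v → High (K₂-arr v) (suc d) y → X
    none y≢ hy = contradiction (subst (suc d ≤_) (K₂-arr-last v y≢) hy) λ ()

module _ {G A B C a b c} (D : Delta G A B C a b c) where
  open Delta D
  open Edge A B C a b c

  at-in₁ : ∀ {v v′} → to v ≡ in₁ v′ → ∀ x → at v x ≡ m̂ (at v′) (to x)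
  at-in₁ {v} {v′} eq x with x ≟ v
  ... | yes refl rewrite eq = sym (at-refl v′)
  ... | no x≢v with to x in eq′
  ...   | in₁ x′ = sym (dec-false (x′ ≟ v′) λ { refl → x≢v (to-inj (trans eq′ (sym eq))) })
  ...   | in₂ _ = refl
  ...   | in₃ _ = refl

  module _ (SC : Simple C) (MB : AllMarked B r) (MC : AllMarked C r) where
    private
      lb = proj₁ (MB b)
      lc = proj₁ (reverseMarked (MC c))
      arr : Arrangement (Fin (n A)) → Arrangement (Fin (n G))
      arr la = pullArr to-inj (concatenate lb la lc)

    Delta-Marked : AllMarked A r → ∀ {v v′} → to v ≡ in₁ v′ →
      Σ (Arrangement (Fin (n G))) λ l → ∀ d → Marked (adj G) (at v) (Low l d) (High l d) (suc r)
    Delta-Marked MA {v} {v′} eq = arr la , λ d →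
      pullMarked {φ = to} pres (at-in₁ eq) (λ _ → id) (λ _ → id)
        (cutCase (λ L R → Marked edge (m̂ (at v′)) L R _) (pullMarked (λ _ _ → refl) (λ _ → refl)) lb la lc
          (λ d → firstMarked (at v′) (proj₂ (MB b) d))
          (λ d → middleMarked (at v′) (Low∩High la d) (proj₂ (MA v′) d))
          (λ d → lastMarked (at v′) (Simple.symm SC) (proj₂ (reverseMarked (MC c)) d))
          d)
      where la = proj₁ (MA v′)

    Delta-Split : AllSplit A r → ∀ {v v′} p e → p ∨ e ≡ true → to v ≡ in₁ v′ →
      Σ (Arrangement (Fin (n G))) λ l → ∀ d → Split (adj G) v p e (Low l d) (High l d) (suc r)
    Delta-Split SA {v} {v′} p e ok eq = arr la , λ d →
      pullSplit pres to-inj (λ _ → id) (λ _ → id)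
        (subst (λ z → Split edge z p e (Low (concatenate lb la lc) d) (High (concatenate lb la lc) d) _) (sym eq)
          (cutCase (λ L R → Split edge (in₁ v′) p e L R _) (pullSplit (λ _ _ → refl) id) lb la lc
            (λ d → firstSplit v′ p e (proj₂ (MB b) d))
            (λ d → middleSplit v′ p e (Low∩High la d) (proj₂ splitA d))
            (λ d → lastSplit v′ p e (Simple.symm SC) (proj₂ (reverseMarked (MC c)) d))
            d))
      where
      -- The corner is toggled in advance to cancel the effect of the pivot in `middleSplit`; the
      -- type stays nonzero, so the hypothesis on `A` covers it.
      splitA = SA v′ p (e xor (p ∧ at a v′)) (nonzero p (at a v′) ok)
      la = proj₁ splitA

InDelta⇒AllMarked : ∀ {G} → InDelta k G → AllMarked G (suc k)
InDelta⇒AllMarked (Δ-base i) v = let l , M = K₂-AllMarked (Iso.to i v) in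
  pullArr (Iso-inj i) l ,
  λ d → pullMarked (Iso.pres i) (at-cong (Iso-inj i) v) (λ _ → id) (λ _ → id) (M d)
InDelta⇒AllMarked (Δ-comp A B C _ _ _ i) v with Delta.to (Iso⇒Delta i) v in eq
... | in₁ _ = Delta-Marked (Iso⇒Delta i) (InDelta⇒simple C)
  (InDelta⇒AllMarked B) (InDelta⇒AllMarked C) (InDelta⇒AllMarked A) eq
-- The part containing `v` is moved into the role of `A`, the part placed in the middle of the
-- arrangement.
... | in₂ _ = Delta-Marked (swap₁₂ (Iso⇒Delta i)) (InDelta⇒simple C)
  (InDelta⇒AllMarked A) (InDelta⇒AllMarked C) (InDelta⇒AllMarked B) (cong σ₁₂ eq)
... | in₃ _ = Delta-Marked (swap₁₃ (Iso⇒Delta i)) (InDelta⇒simple A)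
  (InDelta⇒AllMarked B) (InDelta⇒AllMarked A) (InDelta⇒AllMarked C) (cong σ₁₃ eq)

InDelta⇒AllSplit : ∀ {G} → InDelta k G → AllSplit G (suc k)
InDelta⇒AllSplit (Δ-base i) v p e ok = let l , M = K₂-AllSplit (Iso.to i v) p e ok in
  pullArr (Iso-inj i) l , λ d → pullSplit (Iso.pres i) (Iso-inj i) (λ _ → id) (λ _ → id) (M d)
InDelta⇒AllSplit (Δ-comp A B C _ _ _ i) v p e ok with Delta.to (Iso⇒Delta i) v in eq
... | in₁ _ = Delta-Split (Iso⇒Delta i) (InDelta⇒simple C)
  (InDelta⇒AllMarked B) (InDelta⇒AllMarked C) (InDelta⇒AllSplit A) p e ok eq
... | in₂ _ = Delta-Split (swap₁₂ (Iso⇒Delta i)) (InDelta⇒simple C)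
  (InDelta⇒AllMarked A) (InDelta⇒AllMarked C) (InDelta⇒AllSplit B) p e ok (cong σ₁₂ eq)
... | in₃ _ = Delta-Split (swap₁₃ (Iso⇒Delta i)) (InDelta⇒simple A)
  (InDelta⇒AllMarked B) (InDelta⇒AllMarked A) (InDelta⇒AllSplit C) p e ok (cong σ₁₃ eq)

-- Connectedness and the lower bound

Crossing : ∀ {V : Set} → (V → V → Bool) → (V → Bool) → Set
Crossing E X = ∃ λ x → ∃ λ y → X x ≡ true × X y ≡ false × E x y ≡ true

-- Connectedness is phrased by cuts instead of paths, because the lower bound uses a crossing edge
-- as a new row and column.
Connected : Graph → Set
Connected G = ∀ X {x y} → X x ≡ true → X y ≡ false → Crossing (adj G) X

K₂-connected : Connected K₂
K₂-connected X {zero}     {zero}     p q = contradiction (trans (sym p) q) λ ()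
K₂-connected X {zero}     {suc zero} p q = zero , suc zero , p , q , refl
K₂-connected X {suc zero} {zero}     p q = suc zero , zero , p , q , refl
K₂-connected X {suc zero} {suc zero} p q = contradiction (trans (sym p) q) λ ()

separated : ∀ {G} → Connected G → ∀ X x y → X x ≢ X y → Crossing (adj G) X
separated conn X x y X≢ with X x in p | X y in q
... | true  | true  = contradiction refl X≢
... | true  | false = conn X p q
... | false | true  = conn X q p
... | false | false = contradiction refl X≢

module _ {G A B C a b c} (D : Delta G A B C a b c) where
  open Delta D
  open Edge A B C a b c

  -- If some vertex is separated from the triangle vertex of its part, that part has a crossing
  -- edge; otherwise two triangle vertices are separated, and their edge crosses.
  Delta-connected : Connected A → Connected B → Connected C → Connected G
  Delta-connected cA cB cC X {x} {y} Xx Xy = push (crossing (to x) (to y)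
      (trans (cong X (from-to x)) Xx) (trans (cong X (from-to y)) Xy))
    where
    X̂ : Parts A B C → Bool
    X̂ = X ∘ from
    push : Crossing edge X̂ → Crossing (adj G) X
    push (x , y , p , q , e) = from x , from y , p , q , trans (pres-from x y) e
    root : Parts A B C → Parts A B C
    root (in₁ _) = in₁ a
    root (in₂ _) = in₂ b
    root (in₃ _) = in₃ c
    within : ∀ z → X̂ z ≢ X̂ (root z) → Crossing edge X̂
    within (in₁ z) ne = let x , y , p = separated cA (X̂ ∘ in₁) z a ne in in₁ x , in₁ y , p
    within (in₂ z) ne = let x , y , p = separated cB (λ w → X̂ (in₂ w)) z b ne in in₂ x , in₂ y , p
    within (in₃ z) ne = let x , y , p = separated cC (λ w → X̂ (in₃ w)) z c ne in in₃ x , in₃ y , p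
    triangle : ∀ z w → X̂ (root z) ≡ true → X̂ (root w) ≡ false → edge (root z) (root w) ≡ true
    triangle (in₁ _) (in₁ _) p q = contradiction (trans (sym p) q) λ ()
    triangle (in₁ _) (in₂ _) p q = cong₂ _∧_ (at-refl a) (at-refl b)
    triangle (in₁ _) (in₃ _) p q = cong₂ _∧_ (at-refl a) (at-refl c)
    triangle (in₂ _) (in₁ _) p q = cong₂ _∧_ (at-refl b) (at-refl a)
    triangle (in₂ _) (in₂ _) p q = contradiction (trans (sym p) q) λ ()
    triangle (in₂ _) (in₃ _) p q = cong₂ _∧_ (at-refl b) (at-refl c)
    triangle (in₃ _) (in₁ _) p q = cong₂ _∧_ (at-refl c) (at-refl a)
    triangle (in₃ _) (in₂ _) p q = cong₂ _∧_ (at-refl c) (at-refl b)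
    triangle (in₃ _) (in₃ _) p q = contradiction (trans (sym p) q) λ ()
    crossing : ∀ z w → X̂ z ≡ true → X̂ w ≡ false → Crossing edge X̂
    crossing z w p q with X̂ (root z) in rz | X̂ (root w) in rw
    ... | false | _     = within z λ eq → contradiction (trans (sym p) (trans eq rz)) λ ()
    ... | true  | true  = within w λ eq → contradiction (trans (sym q) (trans eq rw)) λ ()
    ... | true  | false = root z , root w , rz , rw , triangle z w rz rw

  private
    Outer : Parts A B C → Set
    Outer (in₁ _) = ⊤
    Outer (in₂ _) = ⊥
    Outer (in₃ _) = ⊤

    -- The parts `A` and `C` stay joined by the edge between `a` and `c` when `B` is left out.
    outerCrossing : Connected A → Connected C → ∀ (X : Parts A B C → Bool) {x y} →
      X (in₁ x) ≡ true → X (in₃ y) ≡ false →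
      ∃ λ z → ∃ λ w → Outer z × Outer w × X z ≡ true × X w ≡ false × edge z w ≡ true
    outerCrossing cA cC X p q with X (in₁ a) in ra | X (in₃ c) in rc
    ... | false | _     = let x , y , rest = cA (X ∘ in₁) p ra in in₁ x , in₁ y , tt , tt , rest
    ... | true  | true  = let x , y , rest = cC (λ w → X (in₃ w)) rc q in in₃ x , in₃ y , tt , tt , rest
    ... | true  | false = in₁ a , in₃ c , tt , tt , ra , rc , cong₂ _∧_ (at-refl a) (at-refl c)

    edge-outer : ∀ {x} z → Outer z → x ≢ b → edge (in₂ x) z ≡ false
    edge-outer {x} (in₁ z) _ x≢b = cong (_∧ at a z) (dec-false (x ≟ b) x≢b)
    edge-outer {x} (in₃ z) _ x≢b = cong (_∧ at c z) (dec-false (x ≟ b) x≢b)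

    outer-edge : ∀ {x} z → Outer z → x ≢ b → edge z (in₂ x) ≡ false
    outer-edge {x} (in₁ z) _ x≢b = trans (cong (at a z ∧_) (dec-false (x ≟ b) x≢b)) (∧-zeroʳ _)
    outer-edge {x} (in₃ z) _ x≢b = trans (cong (at c z ∧_) (dec-false (x ≟ b) x≢b)) (∧-zeroʳ _)

  -- Since b lies on one side of the cut, the cut matrix is block triangular, with the
  -- cut of B as one block and a crossing edge outside B in the other.
  middle-cut : Connected A → Connected C → (key : Fin (n G) → ℕ) → ∀ d {x y} →
    key (from (in₁ x)) < d → ¬ (key (from (in₃ y)) < d) →
    CutRankGE B (λ z → key (from (in₂ z)) < d) r → CutRankGE G (λ z → key z < d) (suc r)
  middle-cut {r = r} cA cC key d {x} {y} x∈X y∉X (f , f∈X , ind)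
    with outerCrossing cA cC (λ z → does (key (from z) <? d))
           (dec-true (_ <? d) x∈X) (dec-false (_ <? d) y∉X)
  ... | z , w , Oz , Ow , Xz , Xw , zw = f′ , f′∈X , ind′
    where
    z∈X : key (from z) < d
    z∈X = does-true (key (from z) <? d) Xz
    w∉X : ¬ key (from w) < d
    w∉X lt = contradiction (trans (sym (dec-true (_ <? d) lt)) Xw) λ ()
    f′ : Fin (suc r) → Fin (n G)
    f′ zero = from z
    f′ (suc i) = from (in₂ (f i))
    f′∈X : ∀ i → key (f′ i) < d
    f′∈X zero = z∈X
    f′∈X (suc i) = f∈X i
    Odd : (Fin (suc r) → Bool) → Fin (n G) → Set
    Odd S y = parity (λ i → S i ∧ adj G (f′ i) y) ≡ true
    inner : ∀ S → (∃ λ i → S (suc i) ≡ true) →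
      (∀ y → ¬ key (from (in₂ y)) < d → S zero ∧ adj G (from z) (from (in₂ y)) ≡ false) →
      ∃ λ y → ¬ key y < d × Odd S y
    inner S ne vanish = let y , y∉ , odd = ind (S ∘ suc) ne in
      from (in₂ y) , y∉ , cong₂ _xor_ (vanish y y∉)
        (trans (parity-cong λ i → cong (S (suc i) ∧_) (pres-from (in₂ (f i)) (in₂ y))) odd)
    outer : ∀ S → S zero ≡ true → (∀ i → S (suc i) ∧ adj G (from (in₂ (f i))) (from w) ≡ false) →
      ∃ λ y → ¬ key y < d × Odd S y
    outer S S₀ vanish = from w , w∉X ,
      cong₂ _xor_ (cong₂ _∧_ S₀ (trans (pres-from z w) zw)) (parity-false vanish)
    ind′ : ∀ S → (∃ λ i → S i ≡ true) → ∃ λ y → ¬ key y < d × Odd S y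
    ind′ S ne with key (from (in₂ b)) <? d
    -- Columns of `B` outside the cut avoid `b`, so row `z` is zero on them, and any selected row of
    -- `B` is settled inside `B`.
    ... | yes b∈X = case-low (any? λ i → S (suc i) ≟ᵇ true) ne
      where
      case-low : Dec (∃ λ i → S (suc i) ≡ true) → (∃ λ i → S i ≡ true) → ∃ λ y → ¬ key y < d × Odd S y
      case-low (yes later) _ = inner S later λ y y∉ → trans
        (cong (S zero ∧_) (trans (pres-from z (in₂ y)) (outer-edge z Oz λ { refl → y∉ b∈X }))) (∧-zeroʳ _)
      case-low (no none) (zero , S₀) = outer S S₀ λ i → cong (_∧ _) (¬-not λ eq → none (i , eq))
      case-low (no none) (suc i , Sᵢ) = contradiction (i , Sᵢ) none
    -- Rows of `B` inside the cut avoid `b`, so they are zero in column `w`, which settles every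
    -- selection containing `z`.
    ... | no b∉X = case-high (S zero) refl ne
      where
      case-high : ∀ s → S zero ≡ s → (∃ λ i → S i ≡ true) → ∃ λ y → ¬ key y < d × Odd S y
      case-high true S₀ _ = outer S S₀ λ i → trans
        (cong (S (suc i) ∧_) (trans (pres-from (in₂ (f i)) w)
          (edge-outer w Ow λ eq → b∉X (subst (λ v → key (from (in₂ v)) < d) eq (f∈X i)))))
        (∧-zeroʳ _)
      case-high false S₀ (zero , S₀′) = contradiction (trans (sym S₀′) S₀) λ ()
      case-high false S₀ (suc i , Sᵢ) = inner S (i , Sᵢ) λ y _ → cong (_∧ _) S₀

  -- Positive cut-rank gives a row vertex of `A` below the earliest threshold and a column vertex of
  -- `C` beyond the latest, so the middle threshold separates them.
  between : Connected A → Connected C → (key : Fin (n G) → ℕ) → ∀ {cA cB cC} → cA ≤ cB → cB ≤ cC →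
    CutRankGE A (λ z → key (from (in₁ z)) < cA) (suc k) →
    CutRankGE B (λ z → key (from (in₂ z)) < cB) (suc k) →
    CutRankGE C (λ z → key (from (in₃ z)) < cC) (suc k) →
    CutRankGE G (λ z → key z < cB) (suc (suc k))
  between conA conC key {cB = cB} A≤B B≤C (f , f∈X , _) rB (_ , _ , ind) =
    let y , y∉ , _ = ind (λ _ → true) (zero , refl) in
    middle-cut conA conC key cB (<-≤-trans (f∈X zero) A≤B) (λ lt → y∉ (<-≤-trans lt B≤C)) rB

InDelta⇒Connected : ∀ {G} → InDelta k G → Connected G
InDelta⇒Connected (Δ-base i) X {x} {y} Xx Xy =
  let x′ , y′ , p , q , e = K₂-connected (X ∘ from)
        (trans (cong X (from-to x)) Xx) (trans (cong X (from-to y)) Xy)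
  in from x′ , from y′ , p , q , trans (pres _ _) (trans (cong₂ (adj K₂) (to-from x′) (to-from y′)) e)
  where open Iso i
InDelta⇒Connected (Δ-comp A B C _ _ _ i) = Delta-connected (Iso⇒Delta i)
  (InDelta⇒Connected A) (InDelta⇒Connected B) (InDelta⇒Connected C)

-- The cut just after the earlier end of the edge has a nonzero entry.
edge⇒¬KeyLRWLE0 : ∀ G {x y : Fin (n G)} → x ≢ y → adj G x y ≡ true → adj G y x ≡ true → ¬ KeyLRWLE G 0
edge⇒¬KeyLRWLE0 G {x} {y} x≢y xy yx (key , key-inj , thin) with <-cmp (key x) (key y)
... | tri< lt _ _ = thin (suc (key x)) ((λ _ → x) , (λ _ → ≤-refl) ,
        λ { S (zero , S₀) → y , (λ le → <⇒≱ lt (≤-pred le)) ,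
          trans (cong (λ b → (b ∧ _) xor false) S₀) (cong (_xor false) xy) })
... | tri≈ _ eq _ = x≢y (key-inj eq)
... | tri> _ _ lt = thin (suc (key y)) ((λ _ → y) , (λ _ → ≤-refl) ,
        λ { S (zero , S₀) → x , (λ le → <⇒≱ lt (≤-pred le)) ,
          trans (cong (λ b → (b ∧ _) xor false) S₀) (cong (_xor false) yx) })

InDelta⇒¬KeyLRWLE : ∀ {G} → InDelta k G → ¬ KeyLRWLE G k
InDelta⇒¬KeyLRWLE {G = G} (Δ-base i) = edge⇒¬KeyLRWLE0 G {x = from zero} {from (suc zero)}
  (λ eq → contradiction (trans (sym (to-from zero)) (trans (cong to eq) (to-from (suc zero)))) λ ())
  (trans (pres _ _) (cong₂ (adj K₂) (to-from zero) (to-from (suc zero))))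
  (trans (pres _ _) (cong₂ (adj K₂) (to-from (suc zero)) (to-from zero)))
  where open Iso i
InDelta⇒¬KeyLRWLE {k = suc k} {G} (Δ-comp {G₁ = A} {B} {C} iA iB iC a b c i) (key , key-inj , thin) =
  -- A negated `KeyLRWLE` hands over no cut, so the three refutations are nested: inside each, a cut
  -- of rank at least `suc k` may be assumed for that part.
  InDelta⇒¬KeyLRWLE iA (key ∘ from ∘ in₁′ , inj₁-injective ∘ from-inj ∘ key-inj , λ cA rA →
  InDelta⇒¬KeyLRWLE iB (key ∘ from ∘ in₂′ , inj₁-injective ∘ inj₂-injective ∘ from-inj ∘ key-inj , λ cB rB →
  InDelta⇒¬KeyLRWLE iC (key ∘ from ∘ in₃′ , inj₂-injective ∘ inj₂-injective ∘ from-inj ∘ key-inj , λ cC rC →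
  clash rA rB rC (≤-total cA cB) (≤-total cB cC) (≤-total cA cC))))
  where
  D = Iso⇒Delta i
  open Delta D
  conA = InDelta⇒Connected iA
  conB = InDelta⇒Connected iB
  conC = InDelta⇒Connected iC
  in₁′ : Fin (n A) → Parts A B C
  in₁′ x = in₁ x
  in₂′ : Fin (n B) → Parts A B C
  in₂′ x = in₂ x
  in₃′ : Fin (n C) → Parts A B C
  in₃′ x = in₃ x
  -- The thresholds are sorted, and a permutation of the parts puts the median second.
  clash : ∀ {cA cB cC} →
    CutRankGE A (λ z → key (from (in₁ z)) < cA) (suc k) →
    CutRankGE B (λ z → key (from (in₂ z)) < cB) (suc k) →
    CutRankGE C (λ z → key (from (in₃ z)) < cC) (suc k) →
    cA ≤ cB ⊎ cB ≤ cA → cB ≤ cC ⊎ cC ≤ cB → cA ≤ cC ⊎ cC ≤ cA → ⊥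
  clash rA rB rC (inj₁ A≤B) (inj₁ B≤C) _ =
    thin _ (between D conA conC key A≤B B≤C rA rB rC)
  clash rA rB rC (inj₁ A≤B) (inj₂ C≤B) (inj₁ A≤C) =
    thin _ (between (swap₂₃ D) conA conB key A≤C C≤B rA rC rB)
  clash rA rB rC (inj₁ A≤B) (inj₂ C≤B) (inj₂ C≤A) =
    thin _ (between (swap₁₃ (swap₁₂ D)) conC conB key C≤A A≤B rC rA rB)
  clash rA rB rC (inj₂ B≤A) (inj₁ B≤C) (inj₁ A≤C) =
    thin _ (between (swap₁₂ D) conB conC key B≤A A≤C rB rA rC)
  clash rA rB rC (inj₂ B≤A) (inj₁ B≤C) (inj₂ C≤A) =
    thin _ (between (swap₁₂ (swap₁₃ D)) conB conA key B≤C C≤A rB rC rA)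
  clash rA rB rC (inj₂ B≤A) (inj₂ C≤B) _ =
    thin _ (between (swap₁₃ D) conC conA key C≤B B≤A rC rB rA)

theorem3p1 : (k : ℕ) (G : Graph) → InDelta k G →
    ¬ LRWLE G k ×
    (∀ (H : Graph) → VertexMinor H G → suc (n H) ≡ n G → LRWLE H k)
theorem3p1 k G δ =
  (λ lrw → InDelta⇒¬KeyLRWLE δ (LRWLE⇒Key lrw)) ,
  λ H vm size → Key⇒LRWLE (Deletion-thin (minor-AllSplit vm size (InDelta⇒simple δ) (InDelta⇒AllSplit δ)))
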